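{- There is an absolute constant $c>0$ such that for all integers $n\ge 1$ $$ r_3(\mathbb{Z}_4^n) \geq c\,\frac{3^n}{\sqrt{n}}.$$ Consequently there is an absolute constant $c'>0$ such that for all $n\geq 1$ there exists a set $S\subset \mathbb{Z}_4^n$ without proper arithmetic progressions of length $3$ with $|S| \geq c'\, 4^{0.7924\,n}$.
   Context: $\mathbb{Z}_m^n$ denotes the additive group $(\mathbb{Z}/m\mathbb{Z})^n$. A proper arithmetic progression of length $k$ in $\mathbb{Z}_m^n$ is a sequence $x, x+d, \ldots, x+(k-1)d$ (with $x,d\in\mathbb{Z}_m^n$) whose $k$ elements are pairwise distinct. $r_k(\mathbb{Z}_m^n)$ denotes the maximal size of a set $S\subseteq\mathbb{Z}_m^n$ that does not contain a proper arithmetic progression of length $k$. -}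

module Defs where

open import Data.Empty using (⊥-elim)
open import Data.Fin as Fin using (Fin; toℕ)
import Data.Fin.Properties as Fin
open import Data.Integer as ℤ using (+_)
import Data.Integer.Properties as ℤ
open import Data.List using (List; []; _∷_; _++_; map; filter; length; lookup; allFin; cartesianProductWith)
open import Data.List.Extrema.Nat using (max; argmax-sel; xs≤max)
open import Data.List.Membership.Propositional using (_∈_)
open import Data.List.Membership.Propositional.Properties
  using (∈-map⁺; ∈-map⁻; ∈-++⁺ˡ; ∈-++⁺ʳ; ∈-++⁻; ∈-filter⁺; ∈-filter⁻; ∈-lookup; ∈-cartesianProductWith⁺; ∈-allFin)
import Data.List.Membership.DecPropositional as DecMembership
import Data.List.Membership.Setoid.Properties as Membership
open import Data.List.Relation.Binary.Sublist.Propositional using (_⊆_; []; _∷_; _∷ʳ_)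
open import Data.List.Relation.Binary.Sublist.Propositional.Properties using (filter-⊆; All-resp-⊆)
import Data.List.Relation.Unary.All as All
open import Data.List.Relation.Unary.All using (All)
import Data.List.Relation.Unary.AllPairs as AllPairs
open import Data.List.Relation.Unary.Any using (here; there; index)
open import Data.List.Relation.Unary.Unique.Propositional using (Unique)
import Data.List.Relation.Unary.Unique.Propositional.Properties as Unique
open import Data.Nat as ℕ using (ℕ; zero; suc)
open import Data.Nat.DivMod using (_mod_)
import Data.Nat.Properties as ℕ
open import Data.Product using (Σ; ∃; ∃₂; ∃-syntax; _×_; _,_; proj₁; proj₂)
open import Data.Rational as ℚ using (ℚ; mkℚ; 1ℚ; 0ℚ; Positive)
import Data.Rational.Properties as ℚ
open import Data.Rational.Unnormalised as ℚᵘ using (mkℚᵘ)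
import Data.Rational.Unnormalised.Properties as ℚᵘ
open import Data.Sum as Sum using (_⊎_; inj₁; inj₂)
open import Data.Vec using (Vec; []; _∷_; zipWith)
import Data.Vec.Properties as Vec
open import Function using (id)
open import Function.Definitions using (Injective)
open import Level using (0ℓ; Level)
open import Relation.Binary.Definitions using (tri<; tri≈; tri>)
open import Relation.Binary.PropositionalEquality
  using (_≡_; refl; sym; trans; cong; cong₂; subst; subst₂; setoid; module ≡-Reasoning)
open import Relation.Nullary using (¬_; Dec; yes; no)
open import Relation.Nullary.Decidable using (map′; ¬?; _→-dec_)
open import Relation.Unary using (Pred; Decidable)

------------------------------------------------------------------------
-- Positive rational numbers

record ℚ⁺ : Set where
  constructor mkℚ⁺
  field
    value     : ℚ
    .positive : Positive value
open ℚ⁺ public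

infix  4 _<⁺_ _≤⁺_
infixl 7 _*⁺_ _÷⁺_
infixr 8 _^⁺_

_<⁺_ _≤⁺_ : ℚ⁺ → ℚ⁺ → Set
p <⁺ q = value p ℚ.< value q
p ≤⁺ q = value p ℚ.≤ value q

-- Opaque so that the type checker does not normalise rational arithmetic.
opaque
  _*⁺_ _÷⁺_ : ℚ⁺ → ℚ⁺ → ℚ⁺
  mkℚ⁺ p p>0 *⁺ mkℚ⁺ q q>0 = mkℚ⁺ (p ℚ.* q) (ℚ.pos*pos⇒pos p {{p>0}} q {{q>0}})
  mkℚ⁺ p p>0 ÷⁺ mkℚ⁺ q q>0 = mkℚ⁺ (p ℚ.* (ℚ.1/ q) {{ℚ.pos⇒nonZero q {{q>0}}}})
    (ℚ.pos*pos⇒pos p {{p>0}} _ {{ℚ.1/pos⇒pos q {{q>0}}}})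

  value-* : ∀ p q → value (p *⁺ q) ≡ value p ℚ.* value q
  value-* p q = refl

1⁺ 2⁺ : ℚ⁺
1⁺ = mkℚ⁺ 1ℚ _
2⁺ = mkℚ⁺ (+ 2 ℚ./ 1) _

_^⁺_ : ℚ⁺ → ℕ → ℚ⁺
q ^⁺ zero  = 1⁺
q ^⁺ suc k = q *⁺ q ^⁺ k

fromℕ⁺ : (n : ℕ) .{{_ : ℕ.NonZero n}} → ℚ⁺
fromℕ⁺ n = mkℚ⁺ (+ n ℚ./ 1) (ℚ.normalize-pos n 1)

private
  variable
    p q s t u w : ℚ⁺

≤⁺-trans : p ≤⁺ q → q ≤⁺ w → p ≤⁺ w
≤⁺-trans = ℚ.≤-trans

ext : value p ≡ value q → p ≡ q
ext refl = refl

1<2 : 1⁺ <⁺ 2⁺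
1<2 = ℚ.*<* (ℤ.+<+ (ℕ.s≤s (ℕ.s≤s ℕ.z≤n)))

opaque
  unfolding _*⁺_

  *⁺-comm : ∀ p q → p *⁺ q ≡ q *⁺ p
  *⁺-comm p q = ext (ℚ.*-comm (value p) (value q))

  *⁺-assoc : ∀ p q r → (p *⁺ q) *⁺ r ≡ p *⁺ (q *⁺ r)
  *⁺-assoc p q r = ext (ℚ.*-assoc (value p) (value q) (value r))

  *⁺-identityˡ : ∀ p → 1⁺ *⁺ p ≡ p
  *⁺-identityˡ p = ext (ℚ.*-identityˡ (value p))

  *⁺-identityʳ : ∀ p → p *⁺ 1⁺ ≡ p
  *⁺-identityʳ p = ext (ℚ.*-identityʳ (value p))

  ÷-* : ∀ p q → (p ÷⁺ q) *⁺ q ≡ p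
  ÷-* (mkℚ⁺ p _) (mkℚ⁺ q q>0) = ext (begin
    (p ℚ.* 1/q) ℚ.* q ≡⟨ ℚ.*-assoc p 1/q q ⟩
    p ℚ.* (1/q ℚ.* q) ≡⟨ cong (p ℚ.*_) (ℚ.*-inverseˡ q {{ℚ.pos⇒nonZero q {{q>0}}}}) ⟩
    p ℚ.* 1ℚ          ≡⟨ ℚ.*-identityʳ p ⟩
    p                 ∎)
    where open ≡-Reasoning
          1/q : ℚ
          1/q = (ℚ.1/ q) {{ℚ.pos⇒nonZero q {{q>0}}}}

  *-monoʳ-<⁺ : ∀ p → q <⁺ w → p *⁺ q <⁺ p *⁺ w
  *-monoʳ-<⁺ (mkℚ⁺ p p>0) = ℚ.*-monoʳ-<-pos p {{p>0}}

  *-monoˡ-<⁺ : ∀ p → q <⁺ w → q *⁺ p <⁺ w *⁺ p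
  *-monoˡ-<⁺ (mkℚ⁺ p p>0) = ℚ.*-monoˡ-<-pos p {{p>0}}

  *-monoʳ-≤⁺ : ∀ p → q ≤⁺ w → p *⁺ q ≤⁺ p *⁺ w
  *-monoʳ-≤⁺ (mkℚ⁺ p p>0) = ℚ.*-monoˡ-≤-nonNeg p {{ℚ.pos⇒nonNeg p {{p>0}}}}

  *-monoˡ-≤⁺ : ∀ p → q ≤⁺ w → q *⁺ p ≤⁺ w *⁺ p
  *-monoˡ-≤⁺ (mkℚ⁺ p p>0) = ℚ.*-monoʳ-≤-nonNeg p {{ℚ.pos⇒nonNeg p {{p>0}}}}

  *-cancelʳ-<⁺ : ∀ r → p *⁺ r <⁺ q *⁺ r → p <⁺ q
  *-cancelʳ-<⁺ (mkℚ⁺ r r>0) = ℚ.*-cancelʳ-<-nonNeg r {{ℚ.pos⇒nonNeg r {{r>0}}}}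

  *-cancelʳ-≤⁺ : ∀ r → p *⁺ r ≤⁺ q *⁺ r → p ≤⁺ q
  *-cancelʳ-≤⁺ (mkℚ⁺ r r>0) = ℚ.*-cancelʳ-≤-pos r {{r>0}}

*⁺-interchange : ∀ p q r s → (p *⁺ q) *⁺ (r *⁺ s) ≡ (p *⁺ r) *⁺ (q *⁺ s)
*⁺-interchange p q r s = begin
  (p *⁺ q) *⁺ (r *⁺ s) ≡⟨ *⁺-assoc p q _ ⟩
  p *⁺ (q *⁺ (r *⁺ s)) ≡⟨ cong (p *⁺_) (*⁺-assoc q r s) ⟨
  p *⁺ ((q *⁺ r) *⁺ s) ≡⟨ cong (λ z → p *⁺ (z *⁺ s)) (*⁺-comm q r) ⟩
  p *⁺ ((r *⁺ q) *⁺ s) ≡⟨ cong (p *⁺_) (*⁺-assoc r q s) ⟩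
  p *⁺ (r *⁺ (q *⁺ s)) ≡⟨ *⁺-assoc p r _ ⟨
  (p *⁺ r) *⁺ (q *⁺ s) ∎
  where open ≡-Reasoning

*-mono-≤⁺ : p ≤⁺ q → w ≤⁺ s → p *⁺ w ≤⁺ q *⁺ s
*-mono-≤⁺ {q = q} {w = r} p≤q r≤s = ℚ.≤-trans (*-monoˡ-≤⁺ r p≤q) (*-monoʳ-≤⁺ q r≤s)

*-mono-<-≤⁺ : p <⁺ q → w ≤⁺ s → p *⁺ w <⁺ q *⁺ s
*-mono-<-≤⁺ {q = q} {w = r} p<q r≤s = ℚ.<-≤-trans (*-monoˡ-<⁺ r p<q) (*-monoʳ-≤⁺ q r≤s)

*-mono-<⁺ : p <⁺ q → w <⁺ s → p *⁺ w <⁺ q *⁺ s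
*-mono-<⁺ {q = q} {w = r} p<q r<s = ℚ.<-trans (*-monoˡ-<⁺ r p<q) (*-monoʳ-<⁺ q r<s)

<⁺-*1 : ∀ q → 1⁺ <⁺ t → q <⁺ q *⁺ t
<⁺-*1 {t} q 1<t = subst (_<⁺ q *⁺ t) (*⁺-identityʳ q) (*-monoʳ-<⁺ q 1<t)

1<÷ : q <⁺ w → 1⁺ <⁺ w ÷⁺ q
1<÷ {q} {r} q<r = *-cancelʳ-<⁺ {1⁺} {r ÷⁺ q} q
  (subst₂ _<⁺_ (sym (*⁺-identityˡ q)) (sym (÷-* r q)) q<r)

÷< : ∀ q → 1⁺ <⁺ t → q ÷⁺ t <⁺ q
÷< {t} q 1<t = subst (q ÷⁺ t <⁺_) (÷-* q t) (<⁺-*1 (q ÷⁺ t) 1<t)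

dense : ∀ p q → p <⁺ q → ∃[ r ] p <⁺ r × r <⁺ q
dense (mkℚ⁺ p p>0) (mkℚ⁺ q _) p<q with ℚ.<-dense p<q
... | m , p<m , m<q = mkℚ⁺ m (ℚ.positive (ℚ.<-trans (ℚ.positive⁻¹ p {{p>0}}) p<m)) , p<m , m<q

lower-bound : ∀ p q → ∃[ r ] r ≤⁺ p × r ≤⁺ q
lower-bound p q with ℚ.≤-total (value p) (value q)
... | inj₁ p≤q = p , ℚ.≤-refl , p≤q
... | inj₂ q≤p = q , q≤p , ℚ.≤-refl

upper-bound : ∀ p q → ∃[ r ] p ≤⁺ r × q ≤⁺ r
upper-bound p q with ℚ.≤-total (value p) (value q)
... | inj₁ p≤q = q , p≤q , ℚ.≤-refl
... | inj₂ q≤p = p , ℚ.≤-refl , q≤p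

min>1 : ∀ p q → 1⁺ <⁺ p → 1⁺ <⁺ q → ∃[ r ] 1⁺ <⁺ r × r ≤⁺ p × r ≤⁺ q
min>1 p q 1<p 1<q with ℚ.≤-total (value p) (value q)
... | inj₁ p≤q = p , 1<p , ℚ.≤-refl , p≤q
... | inj₂ q≤p = q , 1<q , q≤p , ℚ.≤-refl

halve : ∀ t → 1⁺ <⁺ t → ∃[ s ] 1⁺ <⁺ s × s *⁺ s ≤⁺ t
halve t 1<t with dense 1⁺ t 1<t
... | r , 1<r , r<t with min>1 (t ÷⁺ r) r (1<÷ r<t) 1<r
...   | s , 1<s , s≤t/r , s≤r = s , 1<s ,
        subst (s *⁺ s ≤⁺_) (÷-* t r) (*-mono-≤⁺ {s} {t ÷⁺ r} {s} {r} s≤t/r s≤r)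

^-mono-≤⁺ : ∀ k p q → p ≤⁺ q → p ^⁺ k ≤⁺ q ^⁺ k
^-mono-≤⁺ zero    p q p≤q = ℚ.≤-refl
^-mono-≤⁺ (suc k) p q p≤q = *-mono-≤⁺ {p} {q} {p ^⁺ k} {q ^⁺ k} p≤q (^-mono-≤⁺ k p q p≤q)

^-root : ∀ k t → 1⁺ <⁺ t → ∃[ u ] 1⁺ <⁺ u × u ^⁺ k ≤⁺ t
^-root zero    t 1<t = t , 1<t , ℚ.<⇒≤ 1<t
^-root (suc k) t 1<t =
  let s , 1<s , ss≤t      = halve t 1<t
      v , 1<v , vᵏ≤s      = ^-root k s 1<s
      u , 1<u , u≤s , u≤v = min>1 s v 1<s 1<v
  in u , 1<u , ≤⁺-trans {u *⁺ u ^⁺ k} {s *⁺ s} {t}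
       (*-mono-≤⁺ {u} {s} {u ^⁺ k} {s} u≤s
         (≤⁺-trans {u ^⁺ k} {v ^⁺ k} {s} (^-mono-≤⁺ k u v u≤v) vᵏ≤s)) ss≤t

^-mono-<⁺ : ∀ k .{{_ : ℕ.NonZero k}} p q → p <⁺ q → p ^⁺ k <⁺ q ^⁺ k
^-mono-<⁺ (suc k) p q p<q =
  *-mono-<-≤⁺ {p} {q} {p ^⁺ k} {q ^⁺ k} p<q (^-mono-≤⁺ k p q (ℚ.<⇒≤ p<q))

^-distrib-* : ∀ k p q → (p *⁺ q) ^⁺ k ≡ p ^⁺ k *⁺ q ^⁺ k
^-distrib-* zero    p q = sym (*⁺-identityˡ 1⁺)
^-distrib-* (suc k) p q =
  trans (cong ((p *⁺ q) *⁺_) (^-distrib-* k p q)) (*⁺-interchange p q (p ^⁺ k) (q ^⁺ k))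

1^ : ∀ k → 1⁺ ^⁺ k ≡ 1⁺
1^ zero    = refl
1^ (suc k) = trans (cong (1⁺ *⁺_) (1^ k)) (*⁺-identityˡ 1⁺)

^≤ : ∀ k .{{_ : ℕ.NonZero k}} q → q ≤⁺ 1⁺ → q ^⁺ k ≤⁺ q
^≤ (suc k) q q≤1 = subst (q *⁺ q ^⁺ k ≤⁺_) (*⁺-identityʳ q)
  (*-monoʳ-≤⁺ q (subst (q ^⁺ k ≤⁺_) (1^ k) (^-mono-≤⁺ k q 1⁺ q≤1)))

≤^ : ∀ k .{{_ : ℕ.NonZero k}} q → 1⁺ ≤⁺ q → q ≤⁺ q ^⁺ k
≤^ (suc k) q 1≤q = subst (_≤⁺ q *⁺ q ^⁺ k) (*⁺-identityʳ q)
  (*-monoʳ-≤⁺ q (subst (_≤⁺ q ^⁺ k) (1^ k) (^-mono-≤⁺ k 1⁺ q 1≤q)))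

fromℕ : ℕ → ℚ
fromℕ n = + n ℚ./ 1

fromℕ-suc : ∀ n → fromℕ (suc n) ≡ 1ℚ ℚ.+ fromℕ n
fromℕ-suc n = ℚ.toℚᵘ-injective (begin
  ℚ.toℚᵘ (fromℕ (suc n))              ≈⟨ ℚ.toℚᵘ-fromℚᵘ (mkℚᵘ (+ suc n) 0) ⟩
  mkℚᵘ (+ suc n) 0                    ≈⟨ ℚᵘ.*≡* (cong (ℤ._* + 1) (cong (λ z → + 1 ℤ.+ z) (sym (ℤ.*-identityʳ (+ n))))) ⟩
  mkℚᵘ (+ 1) 0 ℚᵘ.+ mkℚᵘ (+ n) 0      ≈⟨ ℚᵘ.+-congʳ (mkℚᵘ (+ 1) 0) (ℚ.toℚᵘ-fromℚᵘ (mkℚᵘ (+ n) 0)) ⟨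
  ℚ.toℚᵘ 1ℚ ℚᵘ.+ ℚ.toℚᵘ (fromℕ n)     ≈⟨ ℚ.toℚᵘ-homo-+ 1ℚ (fromℕ n) ⟨
  ℚ.toℚᵘ (1ℚ ℚ.+ fromℕ n)             ∎)
  where open ℚᵘ.≃-Reasoning

≤fromℕ : ∀ q → ∃[ n ] q ≤⁺ fromℕ⁺ (suc n)
≤fromℕ (mkℚ⁺ q@(mkℚ (+ m) d _) _) = m , ℚ.toℚᵘ-cancel-≤
  (ℚᵘ.≤-respʳ-≃ (ℚᵘ.≃-sym (ℚ.toℚᵘ-fromℚᵘ (mkℚᵘ (+ suc m) 0)))
    (ℚᵘ.*≤* (subst₂ ℤ._≤_ (ℤ.pos-* m 1) (ℤ.pos-* (suc m) (suc d))
      (ℤ.+≤+ (ℕ.≤-trans (ℕ.≤-reflexive (ℕ.*-identityʳ m))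
        (ℕ.≤-trans (ℕ.n≤1+n m) (ℕ.m≤m*n (suc m) (suc d))))))))

excess : ∀ t → 1⁺ <⁺ t → ∃[ d ] value t ≡ 1ℚ ℚ.+ value d
excess (mkℚ⁺ t _) 1<t = mkℚ⁺ (t ℚ.- 1ℚ) (ℚ.positive 0<t-1) , sym (begin
  1ℚ ℚ.+ (t ℚ.- 1ℚ)     ≡⟨ ℚ.+-comm 1ℚ (t ℚ.- 1ℚ) ⟩
  (t ℚ.- 1ℚ) ℚ.+ 1ℚ     ≡⟨ ℚ.+-assoc t (ℚ.- 1ℚ) 1ℚ ⟩
  t ℚ.+ (ℚ.- 1ℚ ℚ.+ 1ℚ) ≡⟨ cong (t ℚ.+_) (ℚ.+-inverseˡ 1ℚ) ⟩
  t ℚ.+ 0ℚ              ≡⟨ ℚ.+-identityʳ t ⟩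
  t                     ∎)
  where
  open ≡-Reasoning
  0<t-1 : 0ℚ ℚ.< t ℚ.- 1ℚ
  0<t-1 = ℚ.+-monoˡ-< (ℚ.- 1ℚ) 1<t

1≤^ : ∀ k t → 1⁺ ≤⁺ t → 1⁺ ≤⁺ t ^⁺ k
1≤^ k t 1≤t = subst (_≤⁺ t ^⁺ k) (1^ k) (^-mono-≤⁺ k 1⁺ t 1≤t)

bernoulli : ∀ n t d → value t ≡ 1ℚ ℚ.+ value d → 1⁺ ≤⁺ t →
            1ℚ ℚ.+ fromℕ n ℚ.* value d ℚ.≤ value (t ^⁺ n)
bernoulli zero    t d eq 1≤t = ℚ.≤-reflexive (trans (cong (1ℚ ℚ.+_) (ℚ.*-zeroˡ (value d))) (ℚ.+-identityʳ 1ℚ))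
bernoulli (suc n) t d eq 1≤t = begin
  1ℚ ℚ.+ fromℕ (suc n) ℚ.* δ              ≡⟨ cong (λ z → 1ℚ ℚ.+ z ℚ.* δ) (fromℕ-suc n) ⟩
  1ℚ ℚ.+ (1ℚ ℚ.+ fromℕ n) ℚ.* δ           ≡⟨ cong (1ℚ ℚ.+_) (ℚ.*-distribʳ-+ δ 1ℚ (fromℕ n)) ⟩
  1ℚ ℚ.+ (1ℚ ℚ.* δ ℚ.+ fromℕ n ℚ.* δ)     ≡⟨ cong (λ z → 1ℚ ℚ.+ z) (ℚ.+-comm (1ℚ ℚ.* δ) (fromℕ n ℚ.* δ)) ⟩
  1ℚ ℚ.+ (fromℕ n ℚ.* δ ℚ.+ 1ℚ ℚ.* δ)     ≡⟨ ℚ.+-assoc 1ℚ (fromℕ n ℚ.* δ) (1ℚ ℚ.* δ) ⟨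
  (1ℚ ℚ.+ fromℕ n ℚ.* δ) ℚ.+ 1ℚ ℚ.* δ     ≤⟨ ℚ.+-mono-≤ (bernoulli n t d eq 1≤t) (subst₂ ℚ._≤_ (value-* 1⁺ d) (value-* (t ^⁺ n) d) (*-monoˡ-≤⁺ {1⁺} {t ^⁺ n} d (1≤^ n t 1≤t))) ⟩
  T ℚ.+ T ℚ.* δ                           ≡⟨ cong₂ ℚ._+_ (ℚ.*-identityˡ T) (ℚ.*-comm δ T) ⟨
  1ℚ ℚ.* T ℚ.+ δ ℚ.* T                    ≡⟨ ℚ.*-distribʳ-+ T 1ℚ δ ⟨
  (1ℚ ℚ.+ δ) ℚ.* T                        ≡⟨ cong (ℚ._* T) eq ⟨
  value t ℚ.* T                           ≡⟨ value-* t (t ^⁺ n) ⟨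
  value (t ^⁺ suc n)                      ∎
  where
  open ℚ.≤-Reasoning
  T = value (t ^⁺ n)
  δ = value d

archimedean : ∀ t → 1⁺ <⁺ t → ∀ q → ∃[ n ] q ≤⁺ t ^⁺ n
archimedean t 1<t q =
  let d , eq    = excess t 1<t
      n , q/d≤n = ≤fromℕ (q ÷⁺ d)
  in suc n , (begin
    value q                            ≡⟨ cong value (÷-* q d) ⟨
    value ((q ÷⁺ d) *⁺ d)              ≤⟨ *-monoˡ-≤⁺ {q ÷⁺ d} {fromℕ⁺ (suc n)} d q/d≤n ⟩
    value (fromℕ⁺ (suc n) *⁺ d)        ≡⟨ value-* (fromℕ⁺ (suc n)) d ⟩
    fromℕ (suc n) ℚ.* value d          ≡⟨ ℚ.+-identityˡ _ ⟨
    0ℚ ℚ.+ fromℕ (suc n) ℚ.* value d   ≤⟨ ℚ.+-monoˡ-≤ (fromℕ (suc n) ℚ.* value d) (ℚ.<⇒≤ (ℚ.positive⁻¹ 1ℚ)) ⟩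
    1ℚ ℚ.+ fromℕ (suc n) ℚ.* value d   ≤⟨ bernoulli (suc n) t d eq (ℚ.<⇒≤ 1<t) ⟩
    value (t ^⁺ suc n)                 ∎)
  where open ℚ.≤-Reasoning

------------------------------------------------------------------------
-- Positive real numbers: two-sided Dedekind cuts of the positive rationals

record ℝ⁺ : Set₁ where
  field
    lower upper     : Pred ℚ⁺ 0ℓ
    lower-inhabited : ∃ lower
    upper-inhabited : ∃ upper
    lower-closed    : ∀ {q r} → q <⁺ r → lower r → lower q
    upper-closed    : ∀ {q r} → q <⁺ r → upper q → upper r
    lower-rounded   : ∀ {q} → lower q → ∃[ r ] q <⁺ r × lower r
    upper-rounded   : ∀ {r} → upper r → ∃[ q ] q <⁺ r × upper q
    disjoint        : ∀ {q} → lower q → ¬ upper q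
    located         : ∀ {q r} → q <⁺ r → lower q ⊎ upper r
open ℝ⁺ public

≤⇒<⊎≡ : ∀ p q → p ≤⁺ q → p <⁺ q ⊎ p ≡ q
≤⇒<⊎≡ p q p≤q with ℚ.<-cmp (value p) (value q)
... | tri< p<q _ _ = inj₁ p<q
... | tri≈ _ p≡q _ = inj₂ (ext p≡q)
... | tri> _ _ q<p = ⊥-elim (ℚ.<-irrefl refl (ℚ.<-≤-trans q<p p≤q))

module _ (x : ℝ⁺) where
  lower-closed-≤ : q ≤⁺ w → lower x w → lower x q
  lower-closed-≤ {q} {r} q≤r r∈x with ≤⇒<⊎≡ q r q≤r
  ... | inj₁ q<r  = lower-closed x q<r r∈x
  ... | inj₂ refl = r∈x

  upper-closed-≤ : q ≤⁺ w → upper x q → upper x w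
  upper-closed-≤ {q} {r} q≤r q∈x with ≤⇒<⊎≡ q r q≤r
  ... | inj₁ q<r  = upper-closed x q<r q∈x
  ... | inj₂ refl = q∈x

  lower<upper : lower x q → upper x w → q <⁺ w
  lower<upper {q} {r} q∈x r∈x with value q ℚ.<? value r
  ... | yes q<r = q<r
  ... | no  q≮r = ⊥-elim (disjoint x (lower-closed-≤ (ℚ.≮⇒≥ q≮r) q∈x) r∈x)

  within-factor : ∀ t → 1⁺ <⁺ t → ∃[ a ] lower x a × upper x (t *⁺ a)
  within-factor t 1<t =
    let s , 1<s , ss≤t = halve t 1<t
        a , a∈x        = lower-inhabited x
        b , b∈x        = upper-inhabited x
        n , b/a≤sⁿ     = archimedean s 1<s (b ÷⁺ a)
        b≤sⁿa          = subst (_≤⁺ s ^⁺ n *⁺ a) (÷-* b a)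
                           (*-monoˡ-≤⁺ {b ÷⁺ a} {s ^⁺ n} a b/a≤sⁿ)
    in search s 1<s ss≤t n a a∈x (upper-closed-≤ {b} {s ^⁺ n *⁺ a} b≤sⁿa b∈x)
    where
    module _ (s : ℚ⁺) (1<s : 1⁺ <⁺ s) (ss≤t : s *⁺ s ≤⁺ t) where
      search : ∀ n a → lower x a → upper x (s ^⁺ n *⁺ a) → ∃[ a ] lower x a × upper x (t *⁺ a)
      step   : ∀ n a → lower x a → upper x (s ^⁺ n *⁺ (s *⁺ a)) →
               lower x (s *⁺ a) ⊎ upper x (s *⁺ (s *⁺ a)) → ∃[ a ] lower x a × upper x (t *⁺ a)

      search zero    a a∈x u = ⊥-elim (disjoint x a∈x (subst (upper x) (*⁺-identityˡ a) u))
      search (suc n) a a∈x u = step n a a∈x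
        (subst (upper x) (trans (cong (_*⁺ a) (*⁺-comm s (s ^⁺ n))) (*⁺-assoc (s ^⁺ n) s a)) u)
        (located x {s *⁺ a} {s *⁺ (s *⁺ a)} (*-monoʳ-<⁺ {a} {s *⁺ a} s
          (subst (_<⁺ s *⁺ a) (*⁺-identityˡ a) (*-monoˡ-<⁺ {1⁺} {s} a 1<s))))

      step n a a∈x u (inj₁ sa∈x)  = search n (s *⁺ a) sa∈x u
      step n a a∈x u (inj₂ ssa∈x) = a , a∈x , upper-closed-≤ {s *⁺ (s *⁺ a)} {t *⁺ a}
        (subst (_≤⁺ t *⁺ a) (*⁺-assoc s s a) (*-monoˡ-≤⁺ {s *⁺ s} {t} a ss≤t)) ssa∈x

infix  4 _≤ℕ_
infixl 7 _*_ _/_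
infixr 8 _^_ _^[_/_]
infix  9 √_

-- Lower cuts have no greatest element, so the strict inequality below still
-- expresses the non-strict x ≤ n; it also makes x ≤ℕ 0 false.
_≤ℕ_ : ℝ⁺ → ℕ → Set
x ≤ℕ n = ∀ {q} → lower x q → value q ℚ.< + n ℚ./ 1

fromℚ⁺ : ℚ⁺ → ℝ⁺
fromℚ⁺ a = record
  { lower           = _<⁺ a
  ; upper           = a <⁺_
  ; lower-inhabited = a ÷⁺ 2⁺ , ÷< {2⁺} a 1<2
  ; upper-inhabited = a *⁺ 2⁺ , <⁺-*1 {2⁺} a 1<2
  ; lower-closed    = ℚ.<-trans
  ; upper-closed    = λ q<r a<q → ℚ.<-trans a<q q<r
  ; lower-rounded   = λ {q} q<a → let r , q<r , r<a = dense q a q<a in r , q<r , r<a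
  ; upper-rounded   = λ {r} a<r → let q , a<q , q<r = dense a r a<r in q , q<r , a<q
  ; disjoint        = λ q<a a<q → ℚ.<-asym q<a a<q
  ; located         = λ {q} {r} → loc q r
  }
  where
  loc : ∀ q r → q <⁺ r → q <⁺ a ⊎ a <⁺ r
  loc q r q<r with value q ℚ.<? value a
  ... | yes q<a = inj₁ q<a
  ... | no  q≮a = inj₂ (ℚ.≤-<-trans (ℚ.≮⇒≥ q≮a) q<r)

_*_ : ℝ⁺ → ℝ⁺ → ℝ⁺
x * y = record
  { lower           = low
  ; upper           = up
  ; lower-inhabited = let a , a∈x = lower-inhabited x ; b , b∈y = lower-inhabited y
                      in a *⁺ b , a , b , a∈x , b∈y , ℚ.≤-refl
  ; upper-inhabited = let a , a∈x = upper-inhabited x ; b , b∈y = upper-inhabited y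
                      in a *⁺ b , a , b , a∈x , b∈y , ℚ.≤-refl
  ; lower-closed    = λ { q<r (a , b , a∈x , b∈y , r≤ab) → a , b , a∈x , b∈y , ℚ.<⇒≤ (ℚ.<-≤-trans q<r r≤ab) }
  ; upper-closed    = λ { q<r (a , b , a∈x , b∈y , ab≤q) → a , b , a∈x , b∈y , ℚ.<⇒≤ (ℚ.≤-<-trans ab≤q q<r) }
  ; lower-rounded   = λ { (a , b , a∈x , b∈y , q≤ab) →
      let c , a<c , c∈x = lower-rounded x a∈x
      in c *⁺ b , ℚ.≤-<-trans q≤ab (*-monoˡ-<⁺ {a} {c} b a<c) , c , b , c∈x , b∈y , ℚ.≤-refl }
  ; upper-rounded   = λ { (a , b , a∈x , b∈y , ab≤q) →
      let c , c<a , c∈x = upper-rounded x a∈x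
      in c *⁺ b , ℚ.<-≤-trans (*-monoˡ-<⁺ {c} {a} b c<a) ab≤q , c , b , c∈x , b∈y , ℚ.≤-refl }
  ; disjoint        = λ { (a , b , a∈x , b∈y , q≤ab) (a′ , b′ , a′∈x , b′∈y , a′b′≤q) →
      ℚ.<-irrefl refl (ℚ.≤-<-trans q≤ab (ℚ.<-≤-trans
        (*-mono-<⁺ {a} {a′} {b} {b′} (lower<upper x a∈x a′∈x) (lower<upper y b∈y b′∈y)) a′b′≤q)) }
  ; located         = λ {q} {r} → loc q r
  }
  where
  low up : Pred ℚ⁺ 0ℓ
  low q = ∃₂ λ a b → lower x a × lower y b × q ≤⁺ a *⁺ b
  up  q = ∃₂ λ a b → upper x a × upper y b × a *⁺ b ≤⁺ q

  loc : ∀ q r → q <⁺ r → low q ⊎ up r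
  loc q r q<r =
    let s , 1<s , ss≤r/q   = halve (r ÷⁺ q) (1<÷ {q} {r} q<r)
        a , a∈x , sa∈x     = within-factor x s 1<s
        b , b∈y , sb∈y     = within-factor y s 1<s
        bound              = λ (ab≤q : a *⁺ b ≤⁺ q) → begin
          value ((s *⁺ a) *⁺ (s *⁺ b)) ≡⟨ cong value (*⁺-interchange s a s b) ⟩
          value ((s *⁺ s) *⁺ (a *⁺ b)) ≤⟨ *-mono-≤⁺ {s *⁺ s} {r ÷⁺ q} {a *⁺ b} {q} ss≤r/q ab≤q ⟩
          value ((r ÷⁺ q) *⁺ q)        ≡⟨ cong value (÷-* r q) ⟩
          value r                      ∎
    in Sum.map (λ q≤ab → a , b , a∈x , b∈y , q≤ab)
               (λ ab≤q → s *⁺ a , s *⁺ b , sa∈x , sb∈y , bound ab≤q)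
               (ℚ.≤-total (value q) (value (a *⁺ b)))
    where open ℚ.≤-Reasoning

_/_ : ℝ⁺ → ℝ⁺ → ℝ⁺
x / y = record
  { lower           = low
  ; upper           = up
  ; lower-inhabited = let a , a∈x = lower-inhabited x ; b , b∈y = upper-inhabited y
                      in a ÷⁺ b , a , b , a∈x , b∈y , ℚ.≤-reflexive (cong value (÷-* a b))
  ; upper-inhabited = let a , a∈x = upper-inhabited x ; b , b∈y = lower-inhabited y
                      in a ÷⁺ b , a , b , a∈x , b∈y , ℚ.≤-reflexive (cong value (sym (÷-* a b)))
  ; lower-closed    = λ { {q} {r} q<r (a , b , a∈x , b∈y , rb≤a) →
      a , b , a∈x , b∈y , ℚ.<⇒≤ (ℚ.<-≤-trans (*-monoˡ-<⁺ {q} {r} b q<r) rb≤a) }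
  ; upper-closed    = λ { {q} {r} q<r (a , b , a∈x , b∈y , a≤qb) →
      a , b , a∈x , b∈y , ℚ.<⇒≤ (ℚ.≤-<-trans a≤qb (*-monoˡ-<⁺ {q} {r} b q<r)) }
  ; lower-rounded   = λ { {q} (a , b , a∈x , b∈y , qb≤a) →
      let c , a<c , c∈x = lower-rounded x a∈x
      in c ÷⁺ b
       , *-cancelʳ-<⁺ {q} {c ÷⁺ b} b (subst (q *⁺ b <⁺_) (sym (÷-* c b)) (ℚ.≤-<-trans qb≤a a<c))
       , c , b , c∈x , b∈y , ℚ.≤-reflexive (cong value (÷-* c b)) }
  ; upper-rounded   = λ { {q} (a , b , a∈x , b∈y , a≤qb) →
      let c , c<a , c∈x = upper-rounded x a∈x
      in c ÷⁺ b
       , *-cancelʳ-<⁺ {c ÷⁺ b} {q} b (subst (_<⁺ q *⁺ b) (sym (÷-* c b)) (ℚ.<-≤-trans c<a a≤qb))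
       , c , b , c∈x , b∈y , ℚ.≤-reflexive (cong value (sym (÷-* c b))) }
  ; disjoint        = λ { {q} (a , b , a∈x , b∈y , qb≤a) (a′ , b′ , a′∈x , b′∈y , a′≤qb′) →
      ℚ.<-irrefl refl (ℚ.≤-<-trans qb≤a (ℚ.<-trans (lower<upper x a∈x a′∈x)
        (ℚ.≤-<-trans a′≤qb′ (*-monoʳ-<⁺ {b′} {b} q (lower<upper y b′∈y b∈y))))) }
  ; located         = λ {q} {r} → loc q r
  }
  where
  low up : Pred ℚ⁺ 0ℓ
  low q = ∃₂ λ a b → lower x a × upper y b × q *⁺ b ≤⁺ a
  up  q = ∃₂ λ a b → upper x a × lower y b × a ≤⁺ q *⁺ b

  loc : ∀ q r → q <⁺ r → low q ⊎ up r
  loc q r q<r =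
    let s , 1<s , ss≤r/q   = halve (r ÷⁺ q) (1<÷ {q} {r} q<r)
        a , a∈x , sa∈x     = within-factor x s 1<s
        b , b∈y , sb∈y     = within-factor y s 1<s
        bound              = λ (a≤qsb : a ≤⁺ q *⁺ (s *⁺ b)) → begin
          value (s *⁺ a)                 ≤⟨ *-monoʳ-≤⁺ {a} {q *⁺ (s *⁺ b)} s a≤qsb ⟩
          value (s *⁺ (q *⁺ (s *⁺ b)))   ≡⟨ cong value (*⁺-assoc s q (s *⁺ b)) ⟨
          value ((s *⁺ q) *⁺ (s *⁺ b))   ≡⟨ cong value (*⁺-interchange s q s b) ⟩
          value ((s *⁺ s) *⁺ (q *⁺ b))   ≤⟨ *-monoˡ-≤⁺ {s *⁺ s} {r ÷⁺ q} (q *⁺ b) ss≤r/q ⟩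
          value ((r ÷⁺ q) *⁺ (q *⁺ b))   ≡⟨ cong value (*⁺-assoc (r ÷⁺ q) q b) ⟨
          value (((r ÷⁺ q) *⁺ q) *⁺ b)   ≡⟨ cong (λ z → value (z *⁺ b)) (÷-* r q) ⟩
          value (r *⁺ b)                 ∎
    in Sum.map (λ qsb≤a → a , s *⁺ b , a∈x , sb∈y , qsb≤a)
               (λ a≤qsb → s *⁺ a , b , sa∈x , b∈y , bound a≤qsb)
               (ℚ.≤-total (value (q *⁺ (s *⁺ b))) (value a))
    where open ℚ.≤-Reasoning

root : (k : ℕ) .{{_ : ℕ.NonZero k}} → ℝ⁺ → ℝ⁺
root k x = record
  { lower           = λ q → lower x (q ^⁺ k)
  ; upper           = λ q → upper x (q ^⁺ k)
  ; lower-inhabited = let a , a∈x = lower-inhabited x ; b , b≤1 , b≤a = lower-bound 1⁺ a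
                      in b , lower-closed-≤ x (ℚ.≤-trans (^≤ k b b≤1) b≤a) a∈x
  ; upper-inhabited = let a , a∈x = upper-inhabited x ; b , 1≤b , a≤b = upper-bound 1⁺ a
                      in b , upper-closed-≤ x (ℚ.≤-trans a≤b (≤^ k b 1≤b)) a∈x
  ; lower-closed    = λ {q} {r} q<r → lower-closed x (^-mono-<⁺ k q r q<r)
  ; upper-closed    = λ {q} {r} q<r → upper-closed x (^-mono-<⁺ k q r q<r)
  ; lower-rounded   = λ {q} → lower-rnd q
  ; upper-rounded   = λ {q} → upper-rnd q
  ; disjoint        = disjoint x
  ; located         = λ {q} {r} q<r → located x (^-mono-<⁺ k q r q<r)
  }
  where
  open ℚ.≤-Reasoning

  lower-rnd : ∀ q → lower x (q ^⁺ k) → ∃[ r ] q <⁺ r × lower x (r ^⁺ k)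
  lower-rnd q qᵏ∈x =
    let s , qᵏ<s , s∈x      = lower-rounded x qᵏ∈x
        u , 1<u , uᵏ≤s/qᵏ   = ^-root k (s ÷⁺ q ^⁺ k) (1<÷ {q ^⁺ k} {s} qᵏ<s)
        bound               = begin
          value ((u *⁺ q) ^⁺ k)              ≡⟨ cong value (^-distrib-* k u q) ⟩
          value (u ^⁺ k *⁺ q ^⁺ k)           ≤⟨ *-monoˡ-≤⁺ {u ^⁺ k} {s ÷⁺ q ^⁺ k} (q ^⁺ k) uᵏ≤s/qᵏ ⟩
          value ((s ÷⁺ q ^⁺ k) *⁺ q ^⁺ k)    ≡⟨ cong value (÷-* s (q ^⁺ k)) ⟩
          value s                            ∎
    in u *⁺ q , subst (q <⁺_) (*⁺-comm q u) (<⁺-*1 {u} q 1<u)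
     , lower-closed-≤ x {(u *⁺ q) ^⁺ k} {s} bound s∈x

  upper-rnd : ∀ r → upper x (r ^⁺ k) → ∃[ q ] q <⁺ r × upper x (q ^⁺ k)
  upper-rnd r rᵏ∈x =
    let s , s<rᵏ , s∈x      = upper-rounded x rᵏ∈x
        u , 1<u , uᵏ≤rᵏ/s   = ^-root k (r ^⁺ k ÷⁺ s) (1<÷ {s} {r ^⁺ k} s<rᵏ)
        v                   = r ÷⁺ u
        bound               = begin
          value (s *⁺ (r ^⁺ k ÷⁺ s))         ≡⟨ cong value (trans (*⁺-comm s (r ^⁺ k ÷⁺ s)) (÷-* (r ^⁺ k) s)) ⟩
          value (r ^⁺ k)                     ≡⟨ cong (λ z → value (z ^⁺ k)) (÷-* r u) ⟨
          value ((v *⁺ u) ^⁺ k)              ≡⟨ cong value (^-distrib-* k v u) ⟩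
          value (v ^⁺ k *⁺ u ^⁺ k)           ≤⟨ *-monoʳ-≤⁺ {u ^⁺ k} {r ^⁺ k ÷⁺ s} (v ^⁺ k) uᵏ≤rᵏ/s ⟩
          value (v ^⁺ k *⁺ (r ^⁺ k ÷⁺ s))    ∎
    in v , ÷< {u} r 1<u
     , upper-closed-≤ x {s} {v ^⁺ k} (*-cancelʳ-≤⁺ {s} {v ^⁺ k} (r ^⁺ k ÷⁺ s) bound) s∈x

√_ : ℝ⁺ → ℝ⁺
√_ = root 2

real : (n : ℕ) .{{_ : ℕ.NonZero n}} → ℝ⁺
real n = fromℚ⁺ (fromℕ⁺ n)

_^_ : ℝ⁺ → ℕ → ℝ⁺
x ^ zero  = real 1
x ^ suc n = x * x ^ n

-- x ^[ i / k ] is the real power with exponent the rational number i / k.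
_^[_/_] : ℝ⁺ → (i k : ℕ) .{{_ : ℕ.NonZero k}} → ℝ⁺
x ^[ i / k ] = root k (x ^ i)

------------------------------------------------------------------------
-- Progressions in (ℤ/mℤ)ⁿ

ℤ[_]^_ : ℕ → ℕ → Set
ℤ[ m ]^ n = Vec (Fin m) n

infixl 6 _⊕_
_⊕_ : ∀ {m n} .{{_ : ℕ.NonZero m}} → ℤ[ m ]^ n → ℤ[ m ]^ n → ℤ[ m ]^ n
_⊕_ {m} = zipWith (λ a b → (toℕ a ℕ.+ toℕ b) mod m)

module _ {m n : ℕ} .{{_ : ℕ.NonZero m}} where

  term : (x d : ℤ[ m ]^ n) → ℕ → ℤ[ m ]^ n
  term x d zero    = x
  term x d (suc i) = term x d i ⊕ d

  Proper : ℕ → (x d : ℤ[ m ]^ n) → Set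
  Proper k x d = Injective {A = Fin k} _≡_ _≡_ (λ i → term x d (toℕ i))

  -- Finite subsets are represented by duplicate-free lists; the absence of
  -- duplicates is required separately wherever the size matters.
  APFree : ℕ → List (ℤ[ m ]^ n) → Set
  APFree k S = ∀ x d → Proper k x d → ¬ (∀ (i : Fin k) → term x d (toℕ i) ∈ S)

elements : ∀ m n → List (ℤ[ m ]^ n)
elements m zero    = [] ∷ []
elements m (suc n) = cartesianProductWith _∷_ (allFin m) (elements m n)

elements-complete : ∀ {m n} (x : ℤ[ m ]^ n) → x ∈ elements m n
elements-complete []      = here refl
elements-complete (a ∷ x) = ∈-cartesianProductWith⁺ _∷_ (∈-allFin a) (elements-complete x)

elements-unique : ∀ m n → Unique (elements m n)
elements-unique m zero    = All.[] AllPairs.∷ AllPairs.[]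
elements-unique m (suc n) =
  Unique.cartesianProductWith⁺ _∷_ Vec.∷-injective (Unique.allFin⁺ m) (elements-unique m n)

infix 4 _∈?_
_∈?_ : ∀ {m n} (x : ℤ[ m ]^ n) S → Dec (x ∈ S)
_∈?_ = DecMembership._∈?_ (Vec.≡-dec Fin._≟_)

∀? : ∀ {m n} {P : Pred (ℤ[ m ]^ n) 0ℓ} → Decidable P → Dec (∀ x → P x)
∀? P? = map′ (λ ps x → All.lookup ps (elements-complete x)) (λ p → All.universal p _) (All.all? P? _)

proper? : ∀ {m n} .{{_ : ℕ.NonZero m}} k (x d : ℤ[ m ]^ n) → Dec (Proper k x d)
proper? k x d = map′ (λ inj {i} {j} → inj i j) (λ inj i j → inj {i} {j})
  (Fin.all? λ i → Fin.all? λ j →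
    Vec.≡-dec Fin._≟_ (term x d (toℕ i)) (term x d (toℕ j)) →-dec (i Fin.≟ j))

apFree? : ∀ {m n} .{{_ : ℕ.NonZero m}} k → Decidable (APFree {m} {n} k)
apFree? k S = ∀? λ x → ∀? λ d → proper? k x d →-dec ¬? (Fin.all? λ i → term x d (toℕ i) ∈? S)

private
  variable
    a : Level
    A : Set a

sublists : List A → List (List A)
sublists []       = [] ∷ []
sublists (x ∷ xs) = map (x ∷_) (sublists xs) ++ sublists xs

-- The sublists of a duplicate-free enumeration represent every subset.
r : (k m n : ℕ) .{{_ : ℕ.NonZero m}} → ℕ
r k m n = max 0 (map length (filter (apFree? k) (sublists (elements m n))))

⊆⇒∈-sublists : {xs ys : List A} → xs ⊆ ys → xs ∈ sublists ys
⊆⇒∈-sublists []                 = here refl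
⊆⇒∈-sublists (y ∷ʳ p)           = ∈-++⁺ʳ _ (⊆⇒∈-sublists p)
⊆⇒∈-sublists (_∷_ {x} refl p)   = ∈-++⁺ˡ (∈-map⁺ (x ∷_) (⊆⇒∈-sublists p))

∈-sublists⇒⊆ : {xs : List A} (ys : List A) → xs ∈ sublists ys → xs ⊆ ys
∈-sublists⇒⊆ []       (here refl) = []
∈-sublists⇒⊆ (y ∷ ys) p with ∈-++⁻ (map (y ∷_) (sublists ys)) p
... | inj₂ q = y ∷ʳ ∈-sublists⇒⊆ ys q
... | inj₁ q with ∈-map⁻ (y ∷_) q
...   | zs , zs∈ , refl = refl ∷ ∈-sublists⇒⊆ ys zs∈

unique-⊆ : {xs ys : List A} → xs ⊆ ys → Unique ys → Unique xs
unique-⊆ []         _                   = AllPairs.[]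
unique-⊆ (_ ∷ʳ p)   (_  AllPairs.∷ u)   = unique-⊆ p u
unique-⊆ (refl ∷ p) (y∉ AllPairs.∷ u)   = All-resp-⊆ p y∉ AllPairs.∷ unique-⊆ p u

lookup-injective : (xs : List A) → Unique xs → Injective _≡_ _≡_ (lookup xs)
lookup-injective (x ∷ xs) (x∉ AllPairs.∷ u) {Fin.zero}  {Fin.zero}  eq = refl
lookup-injective (x ∷ xs) (x∉ AllPairs.∷ u) {Fin.zero}  {Fin.suc j} eq = ⊥-elim (All.lookup x∉ (∈-lookup j) eq)
lookup-injective (x ∷ xs) (x∉ AllPairs.∷ u) {Fin.suc i} {Fin.zero}  eq = ⊥-elim (All.lookup x∉ (∈-lookup i) (sym eq))
lookup-injective (x ∷ xs) (x∉ AllPairs.∷ u) {Fin.suc i} {Fin.suc j} eq = cong Fin.suc (lookup-injective xs u eq)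

length-mono : {xs ys : List A} → Unique xs → (∀ {x} → x ∈ xs → x ∈ ys) → length xs ℕ.≤ length ys
length-mono {xs = xs} u sub = Fin.injective⇒≤ {f = λ i → index (sub (∈-lookup {xs = xs} i))}
  λ eq → lookup-injective xs u (Membership.index-injective (setoid _) (sub (∈-lookup _)) (sub (∈-lookup _)) eq)

argmax-length : ∀ {P : Pred (List A) 0ℓ} (xss : List (List A)) → P [] → (∀ {xs} → xs ∈ xss → P xs) →
                ∃[ xs ] P xs × length xs ≡ max 0 (map length xss)
argmax-length xss P[] Pxss with argmax-sel id 0 (map length xss)
... | inj₁ max≡0 = [] , P[] , sym max≡0
... | inj₂ max∈ with ∈-map⁻ length max∈
...   | xs , xs∈ , max≡ = xs , Pxss xs∈ , sym max≡

-- Every set contains the empty progression, whence k ≥ 1 here.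
r-attained : ∀ k m n .{{_ : ℕ.NonZero k}} .{{_ : ℕ.NonZero m}} →
             Σ (List (ℤ[ m ]^ n)) λ S → (Unique S × APFree k S) × length S ≡ r k m n
r-attained k@(suc _) m n = argmax-length {P = λ S → Unique S × APFree k S} _ (AllPairs.[] , empty) nonempty
  where
  empty : APFree k []
  empty x d p all with () ← all Fin.zero
  nonempty : ∀ {S} → S ∈ filter (apFree? k) (sublists (elements m n)) → Unique S × APFree k S
  nonempty S∈ with ∈-filter⁻ (apFree? k) {xs = sublists (elements m n)} S∈
  ... | S∈′ , free = unique-⊆ (∈-sublists⇒⊆ _ S∈′) (elements-unique m n) , free

r-maximal : ∀ k m n .{{_ : ℕ.NonZero m}} (S : List (ℤ[ m ]^ n)) → Unique S → APFree k S → length S ℕ.≤ r k m n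
r-maximal k m n S u free = ℕ.≤-trans
  (length-mono u (λ x∈S → ∈-filter⁺ (_∈? S) (elements-complete _) x∈S))
  (All.lookup (xs≤max 0 _) (∈-map⁺ length (∈-filter⁺ (apFree? k)
    (⊆⇒∈-sublists (filter-⊆ (_∈? S) (elements m n)))
    λ x d p all → free x d p (λ i → proj₂ (∈-filter⁻ (_∈? S) {xs = elements m n} (all i))))))

{-# OPTIONS --safe #-}
module Submission where

-- The set of all words over the digits 0, 1, 2 with exactly k ones is free of proper
-- 3-progressions. If x, y, z is a progression of such words, every coordinate where x is 1
-- is one where y is 1; as both have k ones, these coordinates coincide, and elsewhere y is
-- 0 or 2, which forces x and z to agree. So x = z.
--
-- The set has (n choose k) 2ⁿ⁻ᵏ elements. For n = 3 m and k = m, the square of this number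
-- times 6 m + 1 is at least 9ⁿ, by induction on m from the ratio of consecutive terms; hence
-- the bound 3ⁿ / (16 √n) for all n. The second bound follows since 2 · 4⁷⁹²⁴ ≤ 3¹⁰⁰⁰⁰,
-- whence 3ⁿ exceeds 4^(0.7924 n) by the factor 2^(n / 10000), which outgrows √n up to a
-- constant.

open import Data.Fin.Patterns using (0F; 1F; 2F; 3F)
import Data.Integer as ℤ
import Data.Integer.Properties as ℤ
open import Data.List using (List; []; _∷_; _++_; length; map)
open import Data.List.Membership.Propositional using (_∈_)
open import Data.List.Membership.Propositional.Properties using (∈-++⁻; ∈-map⁻)
open import Data.List.Properties using (length-++; length-map)
open import Data.List.Relation.Binary.Disjoint.Propositional using (Disjoint)
import Data.List.Relation.Unary.All as All
import Data.List.Relation.Unary.AllPairs as AllPairs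
open import Data.List.Relation.Unary.Any using (here)
open import Data.List.Relation.Unary.Unique.Propositional using (Unique)
import Data.List.Relation.Unary.Unique.Propositional.Properties as Unique
open import Data.Nat as ℕ using (ℕ; zero; suc; NonZero)
open import Data.Nat.Combinatorics
  using (_C_; nCk≡n!/k![n-k]!; k![n∸k]!∣n!; nCk+nC[k+1]≡[n+1]C[k+1])
open import Data.Nat.DivMod using (_%_; m≡m%n+[m/n]*n; m%n<n; m/n*n≤m; m/n*n≡m)
import Data.Nat.Properties as ℕ
open import Data.Nat.Tactic.RingSolver using (solve-∀)
open import Data.Product using (Σ-syntax; ∃-syntax; _×_; _,_)
import Data.Rational as ℚ
import Data.Rational.Properties as ℚ
open import Data.Rational.Unnormalised as ℚᵘ using (mkℚᵘ)
import Data.Rational.Unnormalised.Properties as ℚᵘ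
open import Data.Sum using (_⊎_; inj₁; inj₂; [_,_]′)
open import Data.Vec using ([]; _∷_)
import Data.Vec.Properties as Vec
open import Relation.Binary.PropositionalEquality
  using (_≡_; _≢_; refl; sym; trans; cong; cong₂; subst)
open import Defs hiding (_*_; _/_; _^_)

-- Words with a fixed number of ones and their progressions.

data Word : ∀ {n} → ℕ → ℤ[ 4 ]^ n → Set where
  []  : Word 0 []
  0∷_ : ∀ {n k} {x : ℤ[ 4 ]^ n} → Word k x → Word k (0F ∷ x)
  1∷_ : ∀ {n k} {x : ℤ[ 4 ]^ n} → Word k x → Word (suc k) (1F ∷ x)
  2∷_ : ∀ {n k} {x : ℤ[ 4 ]^ n} → Word k x → Word k (2F ∷ x)

-- Digitwise: a first term 1 forces the middle term 1, and a middle term 0 or 2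
-- forces equal outer terms.
progression : ∀ {n a b c} (x d : ℤ[ 4 ]^ n) →
              Word a x → Word b (x ⊕ d) → Word c (x ⊕ d ⊕ d) →
              a ℕ.< b ⊎ (a ≡ b × x ≡ x ⊕ d ⊕ d)
progression []       []       []     []     []     = inj₂ (refl , refl)
progression (_ ∷ x) (0F ∷ d) (0∷ u) (0∷ v) (0∷ w) with progression x d u v w
... | inj₁ a<b          = inj₁ a<b
... | inj₂ (refl , x≡z) = inj₂ (refl , cong (0F ∷_) x≡z)
progression (_ ∷ x) (0F ∷ d) (1∷ u) (1∷ v) (1∷ w) with progression x d u v w
... | inj₁ a<b          = inj₁ (ℕ.s≤s a<b)
... | inj₂ (refl , x≡z) = inj₂ (refl , cong (1F ∷_) x≡z)
progression (_ ∷ x) (0F ∷ d) (2∷ u) (2∷ v) (2∷ w) with progression x d u v w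
... | inj₁ a<b          = inj₁ a<b
... | inj₂ (refl , x≡z) = inj₂ (refl , cong (2F ∷_) x≡z)
-- The digits 0, 1, 2 differ at the ends, but the middle word gains a one that the first lacks, so
-- even a tie in the tails becomes strict. The digits 2, 1, 0 with difference 3 behave alike.
progression (_ ∷ x) (1F ∷ d) (0∷ u) (1∷ v) (2∷ w) with progression x d u v w
... | inj₁ a<b        = inj₁ (ℕ.m≤n⇒m≤1+n a<b)
... | inj₂ (refl , _) = inj₁ ℕ.≤-refl
progression (_ ∷ x) (1F ∷ d) (1∷ u) (2∷ v) ()
progression (_ ∷ x) (1F ∷ d) (2∷ u) ()
progression (_ ∷ x) (2F ∷ d) (0∷ u) (2∷ v) (0∷ w) with progression x d u v w
... | inj₁ a<b          = inj₁ a<b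
... | inj₂ (refl , x≡z) = inj₂ (refl , cong (0F ∷_) x≡z)
progression (_ ∷ x) (2F ∷ d) (1∷ u) ()
progression (_ ∷ x) (2F ∷ d) (2∷ u) (0∷ v) (2∷ w) with progression x d u v w
... | inj₁ a<b          = inj₁ a<b
... | inj₂ (refl , x≡z) = inj₂ (refl , cong (2F ∷_) x≡z)
progression (_ ∷ x) (3F ∷ d) (0∷ u) ()
progression (_ ∷ x) (3F ∷ d) (1∷ u) (0∷ v) ()
progression (_ ∷ x) (3F ∷ d) (2∷ u) (1∷ v) (0∷ w) with progression x d u v w
... | inj₁ a<b        = inj₁ (ℕ.m≤n⇒m≤1+n a<b)
... | inj₂ (refl , _) = inj₁ ℕ.≤-refl

-- The recursion follows Pascal's rule, with two blocks that keep `k`, and yields the empty list for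
-- `k` above `n`. The block of digit 0 stands first in both clauses, so that `words-suc` can read
-- monotonicity off the left summand.
words : ∀ n (k : ℕ) → List (ℤ[ 4 ]^ n)
words zero    zero    = [] ∷ []
words zero    (suc k) = []
words (suc n) zero    = map (0F ∷_) (words n zero) ++ map (2F ∷_) (words n zero)
words (suc n) (suc k) =
  map (0F ∷_) (words n (suc k)) ++ map (2F ∷_) (words n (suc k)) ++ map (1F ∷_) (words n k)

∈-words⁻ : ∀ n k {x} → x ∈ words n k → Word k x
∈-words⁻ zero    zero (here refl) = []
∈-words⁻ (suc n) zero x∈ with ∈-++⁻ (map (0F ∷_) (words n zero)) x∈
... | inj₁ p with _ , q , refl ← ∈-map⁻ (0F ∷_) p = 0∷ ∈-words⁻ n zero q
... | inj₂ p with _ , q , refl ← ∈-map⁻ (2F ∷_) p = 2∷ ∈-words⁻ n zero q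
∈-words⁻ (suc n) (suc k) x∈ with ∈-++⁻ (map (0F ∷_) (words n (suc k))) x∈
... | inj₁ p with _ , q , refl ← ∈-map⁻ (0F ∷_) p = 0∷ ∈-words⁻ n (suc k) q
... | inj₂ p with ∈-++⁻ (map (2F ∷_) (words n (suc k))) p
...   | inj₁ p′ with _ , q , refl ← ∈-map⁻ (2F ∷_) p′ = 2∷ ∈-words⁻ n (suc k) q
...   | inj₂ p′ with _ , q , refl ← ∈-map⁻ (1F ∷_) p′ = 1∷ ∈-words⁻ n k q

words-apFree : ∀ n k → APFree 3 (words n k)
words-apFree n k x d proper terms∈
  with progression x d (∈-words⁻ n k (terms∈ 0F)) (∈-words⁻ n k (terms∈ 1F)) (∈-words⁻ n k (terms∈ 2F))
... | inj₁ k<k = ℕ.<-irrefl refl k<k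
-- Properness would identify the distinct indices 0 and 2.
... | inj₂ (_ , x≡z) with () ← proper {0F} {2F} x≡z

map-∷-disjoint : ∀ {n} {a b} (xs ys : List (ℤ[ 4 ]^ n)) → a ≢ b →
                 Disjoint (map (a ∷_) xs) (map (b ∷_) ys)
map-∷-disjoint xs ys a≢b (p , q) with ∈-map⁻ _ p | ∈-map⁻ _ q
... | _ , _ , refl | _ , _ , eq = a≢b (Vec.∷-injectiveˡ eq)

words-unique : ∀ n k → Unique (words n k)
words-unique zero    zero    = All.[] AllPairs.∷ AllPairs.[]
words-unique zero    (suc k) = AllPairs.[]
words-unique (suc n) zero    = Unique.++⁺
  (Unique.map⁺ Vec.∷-injectiveʳ (words-unique n zero))
  (Unique.map⁺ Vec.∷-injectiveʳ (words-unique n zero))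
  (map-∷-disjoint W W λ ())
  where W = words n zero
words-unique (suc n) (suc k) = Unique.++⁺
  (Unique.map⁺ Vec.∷-injectiveʳ (words-unique n (suc k)))
  (Unique.++⁺
    (Unique.map⁺ Vec.∷-injectiveʳ (words-unique n (suc k)))
    (Unique.map⁺ Vec.∷-injectiveʳ (words-unique n k))
    (map-∷-disjoint W W′ λ ()))
  λ { (p , q) → [ (λ q₂ → map-∷-disjoint W W (λ ()) (p , q₂))
                , (λ q₁ → map-∷-disjoint W W′ (λ ()) (p , q₁))
                ]′ (∈-++⁻ (map (2F ∷_) W) q) }
  where
  W  = words n (suc k)
  W′ = words n k

-- Counting the words: binomial coefficients and their growth.

module _ where
  open import Data.Nat using (_+_; _*_; _^_; _∸_; _≤_; _<_; _!)
  open ℕ.≤-Reasoning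

  -- The count is (n choose k) times 2 to the power n - k; multiplying by `2 ^ k` avoids truncated
  -- subtraction and covers `k` above `n`, where both sides vanish. Induction by Pascal's rule.
  length-words : ∀ n k → length (words n k) * 2 ^ k ≡ (n C k) * 2 ^ n
  length-words zero    zero    = refl
  length-words zero    (suc k) = refl
  length-words (suc n) zero    = begin-equality
    length (map (0F ∷_) W ++ map (2F ∷_) W) * 1 ≡⟨ cong (_* 1) (length-++ (map (0F ∷_) W)) ⟩
    (length (map (0F ∷_) W) + length (map (2F ∷_) W)) * 1
      ≡⟨ cong₂ (λ a b → (a + b) * 1) (length-map (0F ∷_) W) (length-map (2F ∷_) W) ⟩
    (length W + length W) * 1     ≡⟨ rearrange (length W) ⟩
    2 * (length W * 1)            ≡⟨ cong (2 *_) (length-words n zero) ⟩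
    2 * ((n C 0) * 2 ^ n)         ≡⟨⟩
    2 * (1 * 2 ^ n)               ≡⟨ cong (2 *_) (ℕ.*-identityˡ (2 ^ n)) ⟩
    2 ^ suc n                     ≡⟨ ℕ.*-identityˡ (2 ^ suc n) ⟨
    (suc n C 0) * 2 ^ suc n       ∎
    where
    W = words n zero
    rearrange : ∀ a → (a + a) * 1 ≡ 2 * (a * 1)
    rearrange = solve-∀
  length-words (suc n) (suc k) = begin-equality
    length (map (0F ∷_) W ++ map (2F ∷_) W ++ map (1F ∷_) W′) * (2 * 2 ^ k)
      ≡⟨ cong (_* (2 * 2 ^ k)) (trans (length-++ (map (0F ∷_) W))
           (cong (length (map (0F ∷_) W) +_) (length-++ (map (2F ∷_) W)))) ⟩
    (length (map (0F ∷_) W) + (length (map (2F ∷_) W) + length (map (1F ∷_) W′))) * (2 * 2 ^ k)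
      ≡⟨ cong₂ (λ a b → (a + b) * (2 * 2 ^ k)) (length-map (0F ∷_) W)
           (cong₂ _+_ (length-map (2F ∷_) W) (length-map (1F ∷_) W′)) ⟩
    (length W + (length W + length W′)) * (2 * 2 ^ k)
      ≡⟨ rearrange (length W) (length W′) (2 ^ k) ⟩
    2 * (length W * (2 * 2 ^ k) + length W′ * 2 ^ k)
      ≡⟨ cong₂ (λ a b → 2 * (a + b)) (length-words n (suc k)) (length-words n k) ⟩
    2 * ((n C suc k) * 2 ^ n + (n C k) * 2 ^ n) ≡⟨ collect (n C suc k) (n C k) (2 ^ n) ⟩
    (n C k + n C suc k) * 2 ^ suc n  ≡⟨ cong (_* 2 ^ suc n) (nCk+nC[k+1]≡[n+1]C[k+1] n k) ⟩
    (suc n C suc k) * 2 ^ suc n      ∎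
    where
    W  = words n (suc k)
    W′ = words n k
    rearrange : ∀ a b p → (a + (a + b)) * (2 * p) ≡ 2 * (a * (2 * p) + b * p)
    rearrange = solve-∀
    collect : ∀ a b p → 2 * (a * p + b * p) ≡ (b + a) * (2 * p)
    collect = solve-∀

  -- The factorial formula free of subtraction and division, ready for cancellation arguments; the
  -- division is exact by `k![n∸k]!∣n!`.
  C-factorials : ∀ j k → ((j + k) C k) * (k ! * j !) ≡ (j + k) !
  C-factorials j k = begin-equality
    ((j + k) C k) * (k ! * j !)
      ≡⟨ cong (λ i → ((j + k) C k) * (k ! * i !)) (ℕ.m+n∸n≡m j k) ⟨
    ((j + k) C k) * (k ! * ((j + k) ∸ k) !)
      ≡⟨ cong (_* (k ! * ((j + k) ∸ k) !)) (nCk≡n!/k![n-k]! k≤j+k) ⟩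
    ((j + k) ! ℕ./ (k ! * ((j + k) ∸ k) !)) * (k ! * ((j + k) ∸ k) !)
      ≡⟨ m/n*n≡m (k![n∸k]!∣n! k≤j+k) ⟩
    (j + k) !
      ∎
    where
    k≤j+k = ℕ.m≤n+m k j
    instance _ = k ℕ.!* ((j + k) ∸ k) !≢0

  C-central : ∀ m → ((m * 3) C m) * (m ! * (m * 2) !) ≡ (m * 3) !
  C-central m = subst (λ n → (n C m) * (m ! * (m * 2) !) ≡ n !) (thrice m) (C-factorials (m * 2) m)
    where
    thrice : ∀ m → m * 2 + m ≡ m * 3
    thrice = solve-∀

  -- The quotient of consecutive coefficients is (3m+3)(3m+2)(3m+1) over (m+1)(2m+2)(2m+1); here it
  -- is cross-multiplied after cancelling one factor m + 1.
  C-central-suc : ∀ m → ((suc m * 3) C suc m) * (2 * ((2 * m + 1) * (m + 1))) ≡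
                        ((m * 3) C m) * (3 * ((3 * m + 1) * (3 * m + 2)))
  -- Multiplied by this factor, both sides become `(suc m * 3) !`.
  C-central-suc m = ℕ.*-cancelʳ-≡ _ _ (suc m * (m ! * (m * 2) !)) (begin-equality
    X′ * (2 * ((2 * m + 1) * (m + 1))) * (suc m * (m ! * (m * 2) !))
      ≡⟨ expand X′ m (m !) ((m * 2) !) ⟩
    X′ * (suc m ! * (suc m * 2) !)
      ≡⟨ C-central (suc m) ⟩
    (suc m * 3) !
      ≡⟨ cong (λ f → (3 + m * 3) * ((2 + m * 3) * ((1 + m * 3) * f))) (C-central m) ⟨
    (3 + m * 3) * ((2 + m * 3) * ((1 + m * 3) * (X * (m ! * (m * 2) !))))
      ≡⟨ collect X m (m ! * (m * 2) !) ⟩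
    X * (3 * ((3 * m + 1) * (3 * m + 2))) * (suc m * (m ! * (m * 2) !)) ∎)
    where
    X  = (m * 3) C m
    X′ = (suc m * 3) C suc m
    instance
      _ = m ℕ.!* (m * 2) !≢0
      _ = ℕ.m*n≢0 (suc m) (m ! * (m * 2) !)
    expand : ∀ x m f g → x * (2 * ((2 * m + 1) * (m + 1))) * ((1 + m) * (f * g)) ≡
                         x * ((1 + m) * f * ((2 + m * 2) * ((1 + m * 2) * g)))
    expand = solve-∀
    collect : ∀ x m d → (3 + m * 3) * ((2 + m * 3) * ((1 + m * 3) * (x * d))) ≡
                        x * (3 * ((3 * m + 1) * (3 * m + 2))) * ((1 + m) * d)
    collect = solve-∀

  -- Among words of length 3m, having m ones is the most frequent case: m is the mode of the
  -- binomial distribution with parameter 1/3.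
  central : ℕ → ℕ
  central m = length (words (m * 3) m)

  -- `central m` is the coefficient times 2 to the power 2m, so the factor 3/2 in the quotient of
  -- coefficients is multiplied by 4, giving 6.
  central-suc : ∀ m → central (suc m) * ((2 * m + 1) * (m + 1)) ≡
                      6 * ((3 * m + 1) * (3 * m + 2)) * central m
  central-suc m = ℕ.*-cancelʳ-≡ _ _ (4 * 2 ^ m) (begin-equality
    central (suc m) * p * (4 * 2 ^ m)             ≡⟨ regroup (central (suc m)) p (2 ^ m) ⟩
    central (suc m) * 2 ^ suc m * (2 * p)         ≡⟨ cong (_* (2 * p)) (length-words (suc m * 3) (suc m)) ⟩
    X′ * 2 ^ (suc m * 3) * (2 * p)                ≡⟨ swap X′ (2 ^ (suc m * 3)) (2 * p) ⟩
    X′ * (2 * p) * 2 ^ (suc m * 3)                ≡⟨ cong (_* 2 ^ (suc m * 3)) (C-central-suc m) ⟩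
    X * (3 * q) * 2 ^ (suc m * 3)                 ≡⟨ collect X q (2 ^ (m * 3)) ⟩
    24 * q * (X * 2 ^ (m * 3))                    ≡⟨ cong (24 * q *_) (length-words (m * 3) m) ⟨
    24 * q * (central m * 2 ^ m)                  ≡⟨ split q (central m) (2 ^ m) ⟩
    6 * q * central m * (4 * 2 ^ m)               ∎)
    where
    X  = (m * 3) C m
    X′ = (suc m * 3) C suc m
    p  = (2 * m + 1) * (m + 1)
    q  = (3 * m + 1) * (3 * m + 2)
    instance
      _ = ℕ.m^n≢0 2 m
      _ = ℕ.m*n≢0 4 (2 ^ m)
    regroup : ∀ c p t → c * p * (4 * t) ≡ c * (2 * t) * (2 * p)
    regroup = solve-∀
    swap : ∀ x t p → x * t * p ≡ x * p * t
    swap = solve-∀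
    collect : ∀ x q t → x * (3 * q) * (2 * (2 * (2 * t))) ≡ 24 * q * (x * t)
    collect = solve-∀
    split : ∀ q c t → 24 * q * (c * t) ≡ 6 * q * c * (4 * t)
    split = solve-∀

  -- The factor 6 m + 1 makes (6 m + 1) * central m ^ 2 / 729 ^ m nondecreasing in m
  -- with value 1 at m = 0.
  central-lower : ∀ m → 729 ^ m ≤ (6 * m + 1) * (central m * central m)
  central-lower zero    = ℕ.≤-refl
  central-lower (suc m) = ℕ.*-cancelʳ-≤ _ _ (p * p) (begin
    729 * 729 ^ m * (p * p)
      ≤⟨ ℕ.*-monoˡ-≤ (p * p) (ℕ.*-monoʳ-≤ 729 (central-lower m)) ⟩
    729 * ((6 * m + 1) * (a * a)) * (p * p)
      ≤⟨ ℕ.m≤m+n _ _ ⟩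
    729 * ((6 * m + 1) * (a * a)) * (p * p)
      -- This cubic is 36(6m+7)q² - 729(6m+1)p². The terms of degree 5 and 4 cancel, and the
      -- remaining coefficients are positive.
      + (486 * (m * m * m) + 1539 * (m * m) + 1188 * m + 279) * (a * a)
      ≡⟨ compare m a ⟩
    (6 * suc m + 1) * (6 * q * a * (6 * q * a))
      ≡⟨ cong (λ z → (6 * suc m + 1) * (z * z)) (central-suc m) ⟨
    (6 * suc m + 1) * (a′ * p * (a′ * p))
      ≡⟨ regroup (6 * suc m + 1) a′ p ⟩
    (6 * suc m + 1) * (a′ * a′) * (p * p)
      ∎)
    where
    a  = central m
    a′ = central (suc m)
    p  = (2 * m + 1) * (m + 1)
    q  = (3 * m + 1) * (3 * m + 2)
    instance
      _ = ℕ.>-nonZero (ℕ.m≤n+m 1 (2 * m))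
      _ = ℕ.>-nonZero (ℕ.m≤n+m 1 m)
      _ = ℕ.m*n≢0 (2 * m + 1) (m + 1)
      _ = ℕ.m*n≢0 p p
    compare : ∀ m a →
      729 * ((6 * m + 1) * (a * a)) * ((2 * m + 1) * (m + 1) * ((2 * m + 1) * (m + 1)))
        + (486 * (m * m * m) + 1539 * (m * m) + 1188 * m + 279) * (a * a) ≡
      (6 * (1 + m) + 1) * (6 * ((3 * m + 1) * (3 * m + 2)) * a * (6 * ((3 * m + 1) * (3 * m + 2)) * a))
    compare = solve-∀
    regroup : ∀ c a p → c * (a * p * (a * p)) ≡ c * (a * a) * (p * p)
    regroup = solve-∀

  words-suc : ∀ n k → length (words n k) ≤ length (words (suc n) k)
  words-suc n zero = begin
    length (words n zero)                 ≡⟨ length-map (0F ∷_) (words n zero) ⟨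
    length (map (0F ∷_) (words n zero))   ≤⟨ ℕ.m≤m+n _ _ ⟩
    _                                     ≡⟨ length-++ (map (0F ∷_) (words n zero)) ⟨
    length (words (suc n) zero)           ∎
  words-suc n (suc k) = begin
    length (words n (suc k))               ≡⟨ length-map (0F ∷_) (words n (suc k)) ⟨
    length (map (0F ∷_) (words n (suc k))) ≤⟨ ℕ.m≤m+n _ _ ⟩
    _                                      ≡⟨ length-++ (map (0F ∷_) (words n (suc k))) ⟨
    length (words (suc n) (suc k))         ∎

  words-mono : ∀ j n k → length (words n k) ≤ length (words (j + n) k)
  words-mono zero    n k = ℕ.≤-refl
  words-mono (suc j) n k = ℕ.≤-trans (words-mono j n k) (words-suc (j + n) k)

  -- The witness is `n / 3`. The at most two leftover coordinates contribute at most 9² = 81 to the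
  -- left side, and by `words-mono` they do not decrease the count.
  words-lower : ∀ n .{{_ : NonZero n}} →
                ∃[ k ] 9 ^ n ≤ 256 * n * (length (words n k) * length (words n k))
  words-lower n = m , (begin
    9 ^ n                              ≡⟨ cong (9 ^_) n≡ ⟩
    9 ^ (j + m * 3)                    ≡⟨ ℕ.^-distribˡ-+-* 9 j (m * 3) ⟩
    9 ^ j * 9 ^ (m * 3)                ≡⟨ cong (λ e → 9 ^ j * 9 ^ e) (ℕ.*-comm m 3) ⟩
    9 ^ j * 9 ^ (3 * m)                ≡⟨ cong (9 ^ j *_) (ℕ.^-*-assoc 9 3 m) ⟨
    9 ^ j * 729 ^ m                    ≤⟨ ℕ.*-mono-≤ (ℕ.^-monoʳ-≤ 9 j≤2) (central-lower m) ⟩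
    81 * ((6 * m + 1) * (central m * central m)) ≡⟨ ℕ.*-assoc 81 (6 * m + 1) _ ⟨
    81 * (6 * m + 1) * (central m * central m)  ≤⟨ ℕ.*-mono-≤ linear (ℕ.*-mono-≤ central≤ central≤) ⟩
    256 * n * (length (words n m) * length (words n m)) ∎)
    where
    m = n ℕ./ 3
    j = n % 3
    n≡ : n ≡ j + m * 3
    n≡ = m≡m%n+[m/n]*n n 3
    j≤2 : j ≤ 2
    j≤2 = ℕ.≤-pred (m%n<n n 3)
    m*3≤n : m * 3 ≤ n
    m*3≤n = ℕ.≤-trans (ℕ.m≤n+m (m * 3) j) (ℕ.≤-reflexive (sym n≡))
    central≤ : central m ≤ length (words n m)
    central≤ = subst (λ i → central m ≤ length (words i m)) (sym n≡) (words-mono j (m * 3) m)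
    linear : 81 * (6 * m + 1) ≤ 256 * n
    linear = begin
      81 * (6 * m + 1)             ≡⟨ regroup m ⟩
      162 * (m * 3) + 81 * 1       ≤⟨ ℕ.+-mono-≤ (ℕ.*-monoʳ-≤ 162 m*3≤n) (ℕ.*-monoʳ-≤ 81 (ℕ.>-nonZero⁻¹ n)) ⟩
      162 * n + 81 * n             ≡⟨ ℕ.*-distribʳ-+ n 162 81 ⟨
      -- Rounding 243 up to the square 256 = 16² makes the final constant 1/16 rational.
      243 * n                      ≤⟨ ℕ.*-monoˡ-≤ n (ℕ.m≤m+n 243 13) ⟩
      256 * n                      ∎
      where
      regroup : ∀ m → 81 * (6 * m + 1) ≡ 162 * (m * 3) + 81 * 1
      regroup = solve-∀

  -- Absorbing the polynomial factor into a power of two.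

  ^-distribʳ-* : ∀ k m n → (m * n) ^ k ≡ m ^ k * n ^ k
  ^-distribʳ-* zero    m n = refl
  ^-distribʳ-* (suc k) m n = trans (cong (m * n *_) (^-distribʳ-* k m n)) (interchange m n (m ^ k) (n ^ k))
    where
    interchange : ∀ a b c d → a * b * (c * d) ≡ a * c * (b * d)
    interchange = solve-∀

  n<2^n : ∀ n → n < 2 ^ n
  n<2^n zero    = ℕ.≤-refl
  n<2^n (suc n) = begin-strict
    suc n             ≤⟨ n<2^n n ⟩
    2 ^ n             <⟨ ℕ.m<m+n (2 ^ n) (ℕ.m≤n⇒m≤n+o 0 (ℕ.m^n>0 2 n)) ⟩
    2 ^ suc n         ∎

  -- With `p = n / k` one has n ≤ k(p+1) ≤ k `2 ^ p`; the k-th power of this suffices because pk ≤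
  -- n.
  ^≤^*2^ : ∀ k n .{{_ : NonZero k}} → n ^ k ≤ k ^ k * 2 ^ n
  ^≤^*2^ k n = begin
    n ^ k                     ≤⟨ ℕ.^-monoˡ-≤ k n≤ ⟩
    (k * 2 ^ p) ^ k           ≡⟨ ^-distribʳ-* k k (2 ^ p) ⟩
    k ^ k * (2 ^ p) ^ k       ≡⟨ cong (k ^ k *_) (ℕ.^-*-assoc 2 p k) ⟩
    k ^ k * 2 ^ (p * k)       ≤⟨ ℕ.*-monoʳ-≤ (k ^ k) (ℕ.^-monoʳ-≤ 2 (m/n*n≤m n k)) ⟩
    k ^ k * 2 ^ n             ∎
    where
    p = n ℕ./ k
    n≤ : n ≤ k * 2 ^ p
    n≤ = begin
      n             ≡⟨ m≡m%n+[m/n]*n n k ⟩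
      n % k + p * k ≤⟨ ℕ.+-monoˡ-≤ (p * k) (ℕ.<⇒≤ (m%n<n n k)) ⟩
      suc p * k     ≡⟨ ℕ.*-comm (suc p) k ⟩
      k * suc p     ≤⟨ ℕ.*-monoʳ-≤ k (n<2^n p) ⟩
      k * 2 ^ p     ∎

  square-cancel-≤ : ∀ {m n} → m * m ≤ n * n → m ≤ n
  square-cancel-≤ mm≤nn = ℕ.≮⇒≥ λ n<m → ℕ.≤⇒≯ mm≤nn (ℕ.*-mono-< n<m n<m)

  -- The slack 2 in 2 * 4 ^ i ≤ 3 ^ k yields a factor 2 ^ n, which absorbs n ^ k.
  4^≤ : ∀ i k n s .{{_ : NonZero k}} → 2 * 4 ^ i ≤ 3 ^ k → 9 ^ n ≤ 256 * n * (s * s) →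
        4 ^ (i * n) ≤ (16 * k * s) ^ k
  4^≤ i k n s 2*4ⁱ≤3ᵏ 9ⁿ≤ = square-cancel-≤ (begin
    -- Squaring yields `2 ^ n` twice. One copy cancels against the growth of `n ^ k` in `bound`; the
    -- other is discarded here.
    A * A                            ≤⟨ ℕ.m≤n*m (A * A) (2 ^ n) ⟩
    2 ^ n * (A * A)                  ≤⟨ ℕ.*-cancelˡ-≤ (2 ^ n) bound ⟩
    k ^ k * (256 * (s * s)) ^ k      ≡⟨ ^-distribʳ-* k k (256 * (s * s)) ⟨
    -- A second factor `k` makes the base the square of `16 * k * s`, so that the square root can be
    -- taken within the naturals.
    (k * (256 * (s * s))) ^ k        ≤⟨ ℕ.^-monoˡ-≤ k (ℕ.m≤n*m _ k) ⟩
    (k * (k * (256 * (s * s)))) ^ k  ≡⟨ cong (_^ k) (square k s) ⟩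
    (16 * k * s * (16 * k * s)) ^ k  ≡⟨ ^-distribʳ-* k (16 * k * s) (16 * k * s) ⟩
    (16 * k * s) ^ k * (16 * k * s) ^ k ∎)
    where
    A = 4 ^ (i * n)
    instance _ = ℕ.m^n≢0 2 n

    2ⁿA≤ : 2 ^ n * A ≤ 3 ^ (k * n)
    2ⁿA≤ = begin
      2 ^ n * A                ≡⟨ cong (2 ^ n *_) (ℕ.^-*-assoc 4 i n) ⟨
      2 ^ n * (4 ^ i) ^ n      ≡⟨ ^-distribʳ-* n 2 (4 ^ i) ⟨
      (2 * 4 ^ i) ^ n          ≤⟨ ℕ.^-monoˡ-≤ n 2*4ⁱ≤3ᵏ ⟩
      (3 ^ k) ^ n              ≡⟨ ℕ.^-*-assoc 3 k n ⟩
      3 ^ (k * n)              ∎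

    bound : 2 ^ n * (2 ^ n * (A * A)) ≤ 2 ^ n * (k ^ k * (256 * (s * s)) ^ k)
    bound = begin
      2 ^ n * (2 ^ n * (A * A))              ≡⟨ interchange (2 ^ n) A ⟩
      2 ^ n * A * (2 ^ n * A)                ≤⟨ ℕ.*-mono-≤ 2ⁿA≤ 2ⁿA≤ ⟩
      3 ^ (k * n) * 3 ^ (k * n)              ≡⟨ ^-distribʳ-* (k * n) 3 3 ⟨
      9 ^ (k * n)                            ≡⟨ cong (9 ^_) (ℕ.*-comm k n) ⟩
      9 ^ (n * k)                            ≡⟨ ℕ.^-*-assoc 9 n k ⟨
      (9 ^ n) ^ k                            ≤⟨ ℕ.^-monoˡ-≤ k 9ⁿ≤ ⟩
      (256 * n * (s * s)) ^ k                ≡⟨ cong (_^ k) (pull n (s * s)) ⟩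
      (n * (256 * (s * s))) ^ k              ≡⟨ ^-distribʳ-* k n (256 * (s * s)) ⟩
      n ^ k * (256 * (s * s)) ^ k            ≤⟨ ℕ.*-monoˡ-≤ ((256 * (s * s)) ^ k) (^≤^*2^ k n) ⟩
      k ^ k * 2 ^ n * (256 * (s * s)) ^ k    ≡⟨ cong (_* (256 * (s * s)) ^ k) (ℕ.*-comm (k ^ k) (2 ^ n)) ⟩
      2 ^ n * k ^ k * (256 * (s * s)) ^ k    ≡⟨ ℕ.*-assoc (2 ^ n) (k ^ k) _ ⟩
      2 ^ n * (k ^ k * (256 * (s * s)) ^ k)  ∎
      where
      interchange : ∀ a b → a * (a * (b * b)) ≡ a * b * (a * b)
      interchange = solve-∀
      pull : ∀ n t → 256 * n * t ≡ n * (256 * t)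
      pull = solve-∀

    square : ∀ k s → k * (k * (256 * (s * s))) ≡ 16 * k * s * (16 * k * s)
    square = solve-∀

-- Casting natural numbers to the rationals.

fromℕ-mono-≤ : ∀ {m n} → m ℕ.≤ n → fromℕ m ℚ.≤ fromℕ n
fromℕ-mono-≤ {m} {n} m≤n = ℚ.toℚᵘ-cancel-≤ (begin
  ℚ.toℚᵘ (fromℕ m)   ≃⟨ ℚ.toℚᵘ-fromℚᵘ (mkℚᵘ (ℤ.+ m) 0) ⟩
  mkℚᵘ (ℤ.+ m) 0     ≤⟨ ℚᵘ.*≤* (ℤ.*-monoʳ-≤-nonNeg (ℤ.+ 1) (ℤ.+≤+ m≤n)) ⟩
  mkℚᵘ (ℤ.+ n) 0     ≃⟨ ℚ.toℚᵘ-fromℚᵘ (mkℚᵘ (ℤ.+ n) 0) ⟨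
  ℚ.toℚᵘ (fromℕ n)   ∎)
  where open ℚᵘ.≤-Reasoning

fromℕ-* : ∀ m n → fromℕ (m ℕ.* n) ≡ fromℕ m ℚ.* fromℕ n
fromℕ-* m n = ℚ.toℚᵘ-injective (begin
  ℚ.toℚᵘ (fromℕ (m ℕ.* n))              ≈⟨ ℚ.toℚᵘ-fromℚᵘ (mkℚᵘ (ℤ.+ (m ℕ.* n)) 0) ⟩
  mkℚᵘ (ℤ.+ (m ℕ.* n)) 0                  ≈⟨ ℚᵘ.*≡* (cong (ℤ._* ℤ.+ 1) (ℤ.pos-* m n)) ⟩
  mkℚᵘ (ℤ.+ m) 0 ℚᵘ.* mkℚᵘ (ℤ.+ n) 0        ≈⟨ ℚᵘ.*-cong (ℚ.toℚᵘ-fromℚᵘ (mkℚᵘ (ℤ.+ m) 0))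
                                                      (ℚ.toℚᵘ-fromℚᵘ (mkℚᵘ (ℤ.+ n) 0)) ⟨
  ℚ.toℚᵘ (fromℕ m) ℚᵘ.* ℚ.toℚᵘ (fromℕ n) ≈⟨ ℚ.toℚᵘ-homo-* (fromℕ m) (fromℕ n) ⟨
  ℚ.toℚᵘ (fromℕ m ℚ.* fromℕ n)          ∎)
  where open ℚᵘ.≃-Reasoning

module _ (m n : ℕ) .{{_ : NonZero m}} .{{_ : NonZero n}} where
  private instance _ = ℕ.m*n≢0 m n

  fromℕ⁺-* : fromℕ⁺ (m ℕ.* n) ≡ fromℕ⁺ m *⁺ fromℕ⁺ n
  fromℕ⁺-* = ext (trans (fromℕ-* m n) (sym (value-* (fromℕ⁺ m) (fromℕ⁺ n))))

fromℕ⁺-^ : ∀ m n .{{_ : NonZero m}} → fromℕ⁺ (m ℕ.^ n) {{ℕ.m^n≢0 m n}} ≡ fromℕ⁺ m ^⁺ n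
fromℕ⁺-^ m zero    = refl
fromℕ⁺-^ m (suc n) = trans (fromℕ⁺-* m (m ℕ.^ n)) (cong (fromℕ⁺ m *⁺_) (fromℕ⁺-^ m n))
  where instance _ = ℕ.m^n≢0 m n

-- From inequalities of natural numbers to Dedekind cuts.

module _ where
  open import Defs using (_*_; _/_; _^_)
  open ℚ.≤-Reasoning

  lower-^ : ∀ a n {q} → lower (fromℚ⁺ a ^ n) q → q <⁺ a ^⁺ n
  lower-^ a zero    q<1 = q<1
  lower-^ a (suc n) (b , c , b<a , c∈aⁿ , q≤bc) =
    ℚ.≤-<-trans q≤bc (*-mono-<⁺ {b} {a} {c} {a ^⁺ n} b<a (lower-^ a n c∈aⁿ))

  -- Clears the constant 1/m, so that later estimates only multiply rationals; strictness comes from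
  -- a < 1/m.
  lower-1÷ : ∀ m y {q} → lower (fromℚ⁺ (1⁺ ÷⁺ m) * y) q → ∃[ b ] lower y b × m *⁺ q <⁺ b
  lower-1÷ m y {q} (a , b , a<1/m , b∈y , q≤ab) = b , b∈y , (begin-strict
    value (m *⁺ q)                ≤⟨ *-monoʳ-≤⁺ {q} {a *⁺ b} m q≤ab ⟩
    value (m *⁺ (a *⁺ b))         ≡⟨ cong value (*⁺-assoc m a b) ⟨
    value ((m *⁺ a) *⁺ b)         <⟨ *-monoˡ-<⁺ {m *⁺ a} {m *⁺ (1⁺ ÷⁺ m)} b (*-monoʳ-<⁺ {a} {1⁺ ÷⁺ m} m a<1/m) ⟩
    value ((m *⁺ (1⁺ ÷⁺ m)) *⁺ b) ≡⟨ cong (λ z → value (z *⁺ b)) (trans (*⁺-comm m (1⁺ ÷⁺ m)) (÷-* 1⁺ m)) ⟩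
    value (1⁺ *⁺ b)               ≡⟨ cong value (*⁺-identityˡ b) ⟩
    value b                       ∎)

  -- Squares are compared instead of roots. Some `d` has n < d² and 16qd < 3ⁿ. If s ≤ q, then 16sd <
  -- 3ⁿ, whence 9ⁿ ≤ n(16s)² < (16sd)² < 9ⁿ.
  3^/√≤ : ∀ s .{{_ : NonZero s}} n .{{_ : NonZero n}} → 9 ℕ.^ n ℕ.≤ 256 ℕ.* n ℕ.* (s ℕ.* s) →
          fromℚ⁺ (1⁺ ÷⁺ fromℕ⁺ 16) * ((real 3 ^ n) / (√ real n)) ≤ℕ s
  3^/√≤ s n 9ⁿ≤ {q} q∈ with lower-1÷ (fromℕ⁺ 16) ((real 3 ^ n) / (√ real n)) {q} q∈
  ... | b , (e , d , e∈3ⁿ , n<d² , bd≤e) , 16q<b = ℚ.≰⇒> λ s≤q → ℚ.<-irrefl refl (begin-strict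
    value (T *⁺ T)                           ≡⟨ cong value (^-distrib-* n (fromℕ⁺ 3) (fromℕ⁺ 3)) ⟨
    value ((fromℕ⁺ 3 *⁺ fromℕ⁺ 3) ^⁺ n)      ≡⟨ cong (λ z → value (z ^⁺ n)) (fromℕ⁺-* 3 3) ⟨
    value (fromℕ⁺ 9 ^⁺ n)                    ≡⟨ cong value (fromℕ⁺-^ 9 n) ⟨
    fromℕ (9 ℕ.^ n)                          ≤⟨ fromℕ-mono-≤ 9ⁿ≤ ⟩
    fromℕ (256 ℕ.* n ℕ.* (s ℕ.* s))          ≡⟨ cong fromℕ (rearrange n s) ⟩
    fromℕ (n ℕ.* (16 ℕ.* s ℕ.* (16 ℕ.* s)))  ≡⟨ cong value (trans (fromℕ⁺-* n (16 ℕ.* s ℕ.* (16 ℕ.* s)))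
                                                  (cong (fromℕ⁺ n *⁺_) (trans (fromℕ⁺-* (16 ℕ.* s) (16 ℕ.* s))
                                                    (cong₂ _*⁺_ (fromℕ⁺-* 16 s) (fromℕ⁺-* 16 s))))) ⟩
    value (fromℕ⁺ n *⁺ (S *⁺ S))             <⟨ *-monoˡ-<⁺ {fromℕ⁺ n} {d ^⁺ 2} (S *⁺ S) n<d² ⟩
    value (d *⁺ (d *⁺ 1⁺) *⁺ (S *⁺ S))       ≡⟨ cong (λ z → value (d *⁺ z *⁺ (S *⁺ S))) (*⁺-identityʳ d) ⟩
    value (d *⁺ d *⁺ (S *⁺ S))               ≡⟨ cong value (*⁺-interchange d d S S) ⟩
    value (d *⁺ S *⁺ (d *⁺ S))               ≡⟨ cong₂ (λ y z → value (y *⁺ z)) (*⁺-comm d S) (*⁺-comm d S) ⟩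
    value (S *⁺ d *⁺ (S *⁺ d))               <⟨ *-mono-<⁺ {S *⁺ d} {T} {S *⁺ d} {T} (Sd<T s≤q) (Sd<T s≤q) ⟩
    value (T *⁺ T)                           ∎)
    where
    T = fromℕ⁺ 3 ^⁺ n
    S = fromℕ⁺ 16 *⁺ fromℕ⁺ s
    instance
      _ = ℕ.m*n≢0 16 s
      _ = ℕ.m*n≢0 (16 ℕ.* s) (16 ℕ.* s)
      _ = ℕ.m*n≢0 n (16 ℕ.* s ℕ.* (16 ℕ.* s))
    Sd<T : fromℕ⁺ s ≤⁺ q → S *⁺ d <⁺ T
    Sd<T s≤q = begin-strict
      value (S *⁺ d)                  ≤⟨ *-monoˡ-≤⁺ {S} {fromℕ⁺ 16 *⁺ q} d (*-monoʳ-≤⁺ {fromℕ⁺ s} {q} (fromℕ⁺ 16) s≤q) ⟩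
      value (fromℕ⁺ 16 *⁺ q *⁺ d)     <⟨ *-monoˡ-<⁺ {fromℕ⁺ 16 *⁺ q} {b} d 16q<b ⟩
      value (b *⁺ d)                  ≤⟨ bd≤e ⟩
      value e                         <⟨ lower-^ (fromℕ⁺ 3) n e∈3ⁿ ⟩
      value T                         ∎
    rearrange : ∀ n s → 256 ℕ.* n ℕ.* (s ℕ.* s) ≡ n ℕ.* (16 ℕ.* s ℕ.* (16 ℕ.* s))
    rearrange = solve-∀

  -- A member of the lower cut of the root has its k-th power below `4 ^ e`. If s ≤ q, then `4 ^ e`
  -- ≤ (cs)ᵏ ≤ (cq)ᵏ ≤ bᵏ < `4 ^ e`.
  4^[/]≤ : ∀ c s .{{_ : NonZero c}} .{{_ : NonZero s}} e k .{{_ : NonZero k}} →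
           4 ℕ.^ e ℕ.≤ (c ℕ.* s) ℕ.^ k → fromℚ⁺ (1⁺ ÷⁺ fromℕ⁺ c) * (real 4 ^[ e / k ]) ≤ℕ s
  4^[/]≤ c s e k 4ᵉ≤ {q} q∈ with lower-1÷ (fromℕ⁺ c) (real 4 ^[ e / k ]) {q} q∈
  ... | b , bᵏ∈4ᵉ , cq<b = ℚ.≰⇒> λ s≤q → ℚ.<-irrefl refl (begin-strict
    value (fromℕ⁺ 4 ^⁺ e)                   ≡⟨ cong value (fromℕ⁺-^ 4 e) ⟨
    fromℕ (4 ℕ.^ e)                         ≤⟨ fromℕ-mono-≤ 4ᵉ≤ ⟩
    fromℕ ((c ℕ.* s) ℕ.^ k)                 ≡⟨ cong value (fromℕ⁺-^ (c ℕ.* s) k) ⟩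
    value (fromℕ⁺ (c ℕ.* s) ^⁺ k)           ≡⟨ cong (λ z → value (z ^⁺ k)) (fromℕ⁺-* c s) ⟩
    value ((fromℕ⁺ c *⁺ fromℕ⁺ s) ^⁺ k)     ≤⟨ ^-mono-≤⁺ k (fromℕ⁺ c *⁺ fromℕ⁺ s) (fromℕ⁺ c *⁺ q)
                                                 (*-monoʳ-≤⁺ {fromℕ⁺ s} {q} (fromℕ⁺ c) s≤q) ⟩
    value ((fromℕ⁺ c *⁺ q) ^⁺ k)            ≤⟨ ^-mono-≤⁺ k (fromℕ⁺ c *⁺ q) b (ℚ.<⇒≤ cq<b) ⟩
    value (b ^⁺ k)                          <⟨ lower-^ (fromℕ⁺ 4) e bᵏ∈4ᵉ ⟩
    value (fromℕ⁺ 4 ^⁺ e)                   ∎)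
    where instance _ = ℕ.m*n≢0 c s

-- For s = 0 the right side would vanish while `9 ^ n` is positive. This supplies the instance that
-- `fromℕ⁺` demands of the size of the set.
nonZero-of-9^≤ : ∀ n s → 9 ℕ.^ n ℕ.≤ 256 ℕ.* n ℕ.* (s ℕ.* s) → NonZero s
nonZero-of-9^≤ n s 9ⁿ≤ = ℕ.m*n≢0⇒m≢0 s {s} {{ss≢0}}
  where
  instance _ = ℕ.>-nonZero (ℕ.≤-trans (ℕ.m^n>0 9 n) 9ⁿ≤)
  ss≢0 : NonZero (s ℕ.* s)
  ss≢0 = ℕ.m*n≢0⇒n≢0 (256 ℕ.* n)

-- Explicit constants for the two bounds.

open Defs using (_*_; _/_; _^_)

corollary3p3 : (Σ[ c ∈ ℝ⁺ ] ((n : ℕ) .{{_ : NonZero n}} → c * ((real 3 ^ n) / (√ real n)) ≤ℕ r 3 4 n))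
    × (Σ[ c′ ∈ ℝ⁺ ] ((n : ℕ) .{{_ : NonZero n}} →
    Σ[ S ∈ List (ℤ[ 4 ]^ n) ] (Unique S × APFree 3 S × c′ * (real 4 ^[ 7924 ℕ.* n / 10000 ]) ≤ℕ length S)))
corollary3p3 =
  (fromℚ⁺ (1⁺ ÷⁺ fromℕ⁺ 16) , λ n {q} q∈ →
    let k , 9ⁿ≤ = words-lower n
        S       = words n k
    in ℚ.<-≤-trans (3^/√≤ (length S) {{nonZero-of-9^≤ n (length S) 9ⁿ≤}} n 9ⁿ≤ {q} q∈)
         (fromℕ-mono-≤ (r-maximal 3 4 n S (words-unique n k) (words-apFree n k)))) ,
  -- The denominator is the factor `16 * k` from `4^≤` at k = 10000.
  (fromℚ⁺ (1⁺ ÷⁺ fromℕ⁺ (16 ℕ.* 10000)) , λ n →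
    let k , 9ⁿ≤ = words-lower n
        S       = words n k
    in S , words-unique n k , words-apFree n k , λ {q} q∈ →
       4^[/]≤ (16 ℕ.* 10000) (length S) {{_}} {{nonZero-of-9^≤ n (length S) 9ⁿ≤}} (7924 ℕ.* n) 10000
         -- The numerical inequality is settled by evaluating the boolean comparison; in binary
         -- logarithms it reads 15849 against about 15849.6.
         (4^≤ 7924 10000 n (length S) (ℕ.≤ᵇ⇒≤ (2 ℕ.* 4 ℕ.^ 7924) (3 ℕ.^ 10000) _) 9ⁿ≤) {q} q∈)
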